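{- Every graph in $\varepsilon_{12}$ is planar.
   Context: All graphs are finite, simple and connected. An Euler graph is a connected graph all of whose nodes have even degree. $\varepsilon_{12}$ is the class of Euler graphs in which every cycle has length $\equiv 1$ or $\equiv 2\pmod 4$ and which contain at least one cycle of each of these two kinds. -}

module Defs where

open import Data.Nat as ℕ using (ℕ; zero; suc; _%_)
open import Data.Fin as Fin using (Fin; zero; suc; toℕ; inject₁; fromℕ)
open import Data.List using (List; map)
open import Data.Nat.ListAction using (sum)
open import Data.Fin.Base using () renaming (_<_ to _<ᶠ_)
open import Data.Bool using (Bool; true; false; if_then_else_)
open import Data.Product using (Σ; ∃; _×_; _,_)
open import Data.Sum using (_⊎_)
open import Data.Rational as ℚ using (ℚ; 0ℚ; 1ℚ)
open import Relation.Binary.PropositionalEquality using (_≡_)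
open import Relation.Nullary using (¬_)
import Data.List as L

record Graph (n : ℕ) : Set where
  field
    adj    : Fin n → Fin n → Bool
    sym    : ∀ u v → adj u v ≡ adj v u
    irrefl : ∀ u → adj u u ≡ false

module _ {n : ℕ} (G : Graph n) where
  open Graph G

  Edge : Fin n → Fin n → Set
  Edge u v = adj u v ≡ true

  data Reach : Fin n → Fin n → Set where
    here : ∀ {u} → Reach u u
    step : ∀ {u v w} → Edge u v → Reach v w → Reach u w

  Connected : Set
  Connected = ∀ u v → Reach u v

  degree : Fin n → ℕ
  degree u = sum (map (λ v → if adj u v then 1 else 0) (L.allFin n))

  Euler : Set
  Euler = Connected × (∀ u → degree u % 2 ≡ 0)

  record Cycle : Set where
    field
      m      : ℕ
      vert   : Fin (suc (suc (suc m))) → Fin n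
      inj    : ∀ i j → vert i ≡ vert j → i ≡ j
      path   : ∀ (i : Fin (suc (suc m))) → Edge (vert (inject₁ i)) (vert (suc i))
      close  : Edge (vert (fromℕ (suc (suc m)))) (vert zero)

  cycleLength : Cycle → ℕ
  cycleLength c = suc (suc (suc (Cycle.m c)))

  InE12 : Set
  InE12 = Euler
        × (∀ (c : Cycle) → (cycleLength c % 4 ≡ 1) ⊎ (cycleLength c % 4 ≡ 2))
        × (Σ Cycle λ c → cycleLength c % 4 ≡ 1)
        × (Σ Cycle λ c → cycleLength c % 4 ≡ 2)

-- Planarity: drawings in the (rational) plane with polygonal arcs
-- (Diestel's definition of plane graphs, with ℚ² in place of ℝ²)

Point : Set
Point = ℚ × ℚ

OnSeg : Point → Point → ℚ → Point → Set
OnSeg (a₁ , a₂) (b₁ , b₂) t (x₁ , x₂) =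
  (0ℚ ℚ.≤ t) × (t ℚ.≤ 1ℚ)
  × (x₁ ≡ a₁ ℚ.+ t ℚ.* (b₁ ℚ.- a₁))
  × (x₂ ≡ a₂ ℚ.+ t ℚ.* (b₂ ℚ.- a₂))

record PolyArc : Set where
  field
    len : ℕ
    pt  : Fin (suc (suc len)) → Point

module _ (a : PolyArc) where
  open PolyArc a

  startPt endPt : Point
  startPt = pt zero
  endPt   = pt (fromℕ (suc len))

  OnArcAt : Fin (suc len) → ℚ → Point → Set
  OnArcAt i t X = OnSeg (pt (inject₁ i)) (pt (suc i)) t X

  OnArc : Point → Set
  OnArc X = Σ (Fin (suc len)) λ i → Σ ℚ λ t → OnArcAt i t X

  -- the arc does not meet itself: the parametrisation is injective up to
  -- the identification of the end of segment i with the start of segment i+1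
  SimpleArc : Set
  SimpleArc = ∀ i j t s X → OnArcAt i t X → OnArcAt j s X →
                ((i ≡ j) × (t ≡ s))
              ⊎ ((toℕ j ≡ suc (toℕ i)) × (t ≡ 1ℚ) × (s ≡ 0ℚ))
              ⊎ ((toℕ i ≡ suc (toℕ j)) × (s ≡ 1ℚ) × (t ≡ 0ℚ))

Planar : {n : ℕ} → Graph n → Set
Planar {n} G =
  Σ (Fin n → Point) λ pos →
  Σ (Fin n → Fin n → PolyArc) λ arc →
    (∀ u v → pos u ≡ pos v → u ≡ v)
  × (∀ u v → u <ᶠ v → Edge G u v →
       SimpleArc (arc u v) × (startPt (arc u v) ≡ pos u) × (endPt (arc u v) ≡ pos v))
  × (∀ u v w → u <ᶠ v → Edge G u v → OnArc (arc u v) (pos w) → (w ≡ u) ⊎ (w ≡ v))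
  × (∀ u v x y → u <ᶠ v → x <ᶠ y → Edge G u v → Edge G x y → ¬ ((u ≡ x) × (v ≡ y)) →
       ∀ X → OnArc (arc u v) X → OnArc (arc x y) X → Σ (Fin n) λ w → X ≡ pos w)

{-# OPTIONS --safe #-}
module Submission where

-- A K₄ subdivision always has a cycle whose length is 0 or 3 modulo 4, so G has none.
-- A graph all of whose vertices have three neighbours contains a K₄ subdivision: rotate
-- a maximal path so that the chord from its first vertex cuts off as little as possible.
-- Hence some vertex has at most two neighbours; deleting it and joining them by an edge
-- that carries the length of the detour keeps all cycle weights among 1, 2 modulo 4.
-- Undoing the eliminations builds a two-page book embedding, in which a vertex attached
-- to an edge x y goes next to x or next to y. Drawing each edge as a tent over or under
-- the spine makes it a plane drawing.

open import Defs
open import Data.Nat as ℕ using (ℕ; zero; suc; z≤n; s≤s; _%_)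
import Data.Nat.Properties as ℕₚ
open import Data.Nat.DivMod using (%-distribˡ-+; m%n%n≡m%n; m%n<n)
open import Data.Nat.Solver using (module +-*-Solver)
open import Data.Fin as Fin using (Fin; zero; suc; #_; punchIn; punchOut)
open import Data.Fin.Base using () renaming (_<_ to _<ᶠ_)
import Data.Fin.Properties as Finₚ
open import Data.Bool using (Bool; true; false; _∧_; _∨_; not; if_then_else_)
import Data.Bool.Properties as Boolₚ
open import Data.List using (List; []; _∷_; _++_; _∷ʳ_; reverse; length; lookup; [_]; initLast; _∷ʳ′_)
import Data.List.Properties as Listₚ
open import Data.List.Membership.Propositional using (_∈_)
open import Data.List.Membership.Propositional.Properties using (∈-∃++; ∈-++⁻; ∈-++⁺ˡ; ∈-++⁺ʳ)
import Data.List.Membership.DecPropositional as DecMembership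
open import Data.List.Relation.Unary.Any using (here; there)
open import Data.List.Relation.Unary.Any.Properties using (reverse⁻)
open import Data.Vec as Vec using (Vec; []; _∷_)
open import Data.Vec.Functional using (insertAt)
open import Data.Vec.Functional.Properties using (insertAt-lookup; insertAt-punchIn)
open import Data.Rational as ℚ using (ℚ; 0ℚ; 1ℚ)
import Data.Rational.Properties as ℚₚ
import Data.Rational.Solver as ℚ-Solver
open import Algebra.Properties.Group ℚₚ.+-0-group using () renaming (∙-cancelˡ to +-cancelˡ)
open import Data.Product using (Σ; ∃; _×_; _,_; proj₁; proj₂)
open import Data.Sum as Sum using (_⊎_; inj₁; inj₂)
open import Data.Unit using (⊤; tt)
open import Data.Empty using (⊥; ⊥-elim)
open import Function using (_∘_)
open import Relation.Nullary using (¬_; Dec; yes; no; does; contradiction)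
open import Relation.Nullary.Decidable using (True; toWitness; dec-true; dec-false; _→-dec_; _⊎-dec_; _×-dec_; ¬?)
open import Relation.Binary.Definitions using (tri<; tri≈; tri>)
open import Relation.Binary.PropositionalEquality using (_≡_; _≢_; refl; sym; trans; cong; cong₂; subst; module ≡-Reasoning)

-- Graphs without a K₄ subdivision are exactly those that can be reduced to nothing by deleting
-- vertices of degree at most two and joining their neighbours. Two obstacles shape the induction
-- along this reduction. Cycle lengths are not inherited, because the new edge replaces a path
-- through the deleted vertex; hence the induction runs over weighted graphs, and unit weights are
-- only its starting point. A polygonal drawing would be a poor induction hypothesis, because
-- placing a vertex beside an arc needs estimates of the free space around it. In a book embedding
-- the only question is where the vertex enters a linear order, and coordinates appear once, after
-- the induction.

-- Two-page book embeddings: page true is drawn above the spine, page false below;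
-- page a b is meaningful only for rank a < rank b. Uniqueness of the left upper and
-- of the right lower neighbour is what leaves room for a further vertex at an edge.
record Layout {n : ℕ} (G : Graph n) : Set where
  field
    rank           : Fin n → ℕ
    rank-injective : ∀ a b → rank a ≡ rank b → a ≡ b
    page           : Fin n → Fin n → Bool
    noncrossing    : ∀ {a b c d} → Edge G a b → Edge G c d → page a b ≡ page c d →
                     rank a ℕ.< rank c → rank c ℕ.< rank b → rank b ℕ.< rank d → ⊥
    left-unique    : ∀ {a b c} → Edge G a c → Edge G b c → page a c ≡ true → page b c ≡ true →
                     rank a ℕ.< rank c → rank b ℕ.< rank c → a ≡ b
    right-unique   : ∀ {a b c} → Edge G a b → Edge G a c → page a b ≡ false → page a c ≡ false →
                     rank a ℕ.< rank b → rank a ℕ.< rank c → b ≡ c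

-- Plane drawings of book embeddings

module Tents where
  open import Data.Rational using (_+_; _*_; _-_; -_; _≤_; _<_)
  open ℚ-Solver.+-*-Solver

  0≤* : ∀ {x y} → 0ℚ ≤ x → 0ℚ ≤ y → 0ℚ ≤ x * y
  0≤* {x} {y} 0≤x 0≤y =
    ℚₚ.nonNegative⁻¹ _ {{ℚₚ.nonNeg*nonNeg⇒nonNeg x {{ℚ.nonNegative 0≤x}} y {{ℚ.nonNegative 0≤y}}}}

  0≤+ : ∀ {x y} → 0ℚ ≤ x → 0ℚ ≤ y → 0ℚ ≤ x + y
  0≤+ 0≤x 0≤y = ℚₚ.+-mono-≤ 0≤x 0≤y

  ≤⇒0≤- : ∀ {x y} → x ≤ y → 0ℚ ≤ y - x
  ≤⇒0≤- {x} {y} x≤y = subst (_≤ y - x) (ℚₚ.+-inverseʳ x) (ℚₚ.+-monoˡ-≤ (- x) x≤y)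

  <⇒0<- : ∀ {x y} → x < y → 0ℚ < y - x
  <⇒0<- {x} {y} x<y = subst (_< y - x) (ℚₚ.+-inverseʳ x) (ℚₚ.+-monoˡ-< (- x) x<y)

  -+-cancel : ∀ x y → (y - x) + x ≡ y
  -+-cancel = solve 2 (λ x y → (y :- x) :+ x := y) refl

  0≤-⇒≤ : ∀ {x y} → 0ℚ ≤ y - x → x ≤ y
  0≤-⇒≤ {x} {y} le = subst (_≤ y) (ℚₚ.+-identityˡ x)
    (ℚₚ.≤-trans (ℚₚ.+-monoˡ-≤ x le) (ℚₚ.≤-reflexive (-+-cancel x y)))

  -≡0⇒≡ : ∀ {x y} → y - x ≡ 0ℚ → y ≡ x
  -≡0⇒≡ {x} {y} eq = trans (sym (-+-cancel x y)) (trans (cong (_+ x) eq) (ℚₚ.+-identityˡ x))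

  *-cancelʳ : ∀ {x y z} → z ≢ 0ℚ → x * z ≡ y * z → x ≡ y
  *-cancelʳ {x} {y} {z} z≢0 eq = trans (sym (undo x)) (trans (cong (_* 1/z) eq) (undo y))
    where
    instance _ = ℚ.≢-nonZero z≢0
    1/z = ℚ.1/ z
    undo : ∀ a → a * z * 1/z ≡ a
    undo a = trans (ℚₚ.*-assoc a z 1/z) (trans (cong (a *_) (ℚₚ.*-inverseʳ z)) (ℚₚ.*-identityʳ a))

  *≡0⇒≡0 : ∀ {x z} → z ≢ 0ℚ → x * z ≡ 0ℚ → x ≡ 0ℚ
  *≡0⇒≡0 {x} {z} z≢0 eq = *-cancelʳ z≢0 (trans eq (sym (ℚₚ.*-zeroˡ z)))

  double-injective : ∀ {x y} → x + x ≡ y + y → x ≡ y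
  double-injective {x} {y} eq with ℚₚ.<-cmp x y
  ... | tri< x<y _ _ = contradiction (ℚₚ.+-mono-< x<y x<y) (ℚₚ.<-irrefl eq)
  ... | tri≈ _ x≡y _ = x≡y
  ... | tri> _ _ y<x = contradiction (ℚₚ.+-mono-< y<x y<x) (ℚₚ.<-irrefl (sym eq))

  -- The tent over [2a , 2b] has apex (a + b , (b − a)²): its slope b − a grows with
  -- its width, so that nested tents sharing an end meet only there.
  record Tent (a b X Y : ℚ) : Set where
    field
      0≤Y    : 0ℚ ≤ Y
      0≤left : 0ℚ ≤ X - (a + a)
      0≤right : 0ℚ ≤ (b + b) - X
      ≤left  : Y ≤ (X - (a + a)) * (b - a)
      ≤right : Y ≤ ((b + b) - X) * (b - a)
      on     : Y ≡ (X - (a + a)) * (b - a) ⊎ Y ≡ ((b + b) - X) * (b - a)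
  open Tent

  rising : ∀ {a b τ X Y} → a < b → 0ℚ ≤ τ → τ ≤ 1ℚ →
           X ≡ (a + a) + τ * (b - a) → Y ≡ τ * ((b - a) * (b - a)) → Tent a b X Y
  rising {a} {b} {τ} a<b 0≤τ τ≤1 refl refl = record
    { 0≤Y     = 0≤* 0≤τ (0≤* 0≤W 0≤W)
    ; 0≤left  = subst (0ℚ ≤_) (sym left≡) (0≤* 0≤τ 0≤W)
    ; 0≤right = subst (0ℚ ≤_) right≡ (0≤+ (0≤* 0≤1-τ 0≤W) 0≤W)
    ; ≤left   = ℚₚ.≤-reflexive on-left
    -- At parameter `τ` the line of the right side lies 2(1 - τ)(b - a)² above the left side.
    ; ≤right  = 0≤-⇒≤ (subst (0ℚ ≤_) gap≡ (0≤+ 0≤slack 0≤slack))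
    ; on      = inj₁ on-left }
    where
    0≤W = ≤⇒0≤- (ℚₚ.<⇒≤ a<b)
    0≤1-τ = ≤⇒0≤- τ≤1
    0≤slack = 0≤* 0≤1-τ (0≤* 0≤W 0≤W)
    left≡ : ((a + a) + τ * (b - a)) - (a + a) ≡ τ * (b - a)
    left≡ = solve 3 (λ a b τ → ((a :+ a) :+ τ :* (b :- a)) :- (a :+ a) := τ :* (b :- a)) refl a b τ
    right≡ : (1ℚ - τ) * (b - a) + (b - a) ≡ (b + b) - ((a + a) + τ * (b - a))
    right≡ = solve 3 (λ a b τ → (con 1ℚ :- τ) :* (b :- a) :+ (b :- a) := (b :+ b) :- ((a :+ a) :+ τ :* (b :- a))) refl a b τ
    on-left : τ * ((b - a) * (b - a)) ≡ (((a + a) + τ * (b - a)) - (a + a)) * (b - a)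
    on-left = solve 3 (λ a b τ → τ :* ((b :- a) :* (b :- a)) := (((a :+ a) :+ τ :* (b :- a)) :- (a :+ a)) :* (b :- a)) refl a b τ
    gap≡ : (1ℚ - τ) * ((b - a) * (b - a)) + (1ℚ - τ) * ((b - a) * (b - a))
         ≡ ((b + b) - ((a + a) + τ * (b - a))) * (b - a) - τ * ((b - a) * (b - a))
    gap≡ = solve 3 (λ a b τ →
      (con 1ℚ :- τ) :* ((b :- a) :* (b :- a)) :+ (con 1ℚ :- τ) :* ((b :- a) :* (b :- a))
      := ((b :+ b) :- ((a :+ a) :+ τ :* (b :- a))) :* (b :- a) :- τ :* ((b :- a) :* (b :- a))) refl a b τ

  -- Reflection in the vertical axis exchanges the two sides of a tent, so that `falling` follows
  -- from `rising`.
  mirror : ∀ {a b X Y} → Tent (- b) (- a) (- X) Y → Tent a b X Y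
  mirror {a} {b} {X} {Y} T = record
    { 0≤Y     = 0≤Y T
    ; 0≤left  = subst (0ℚ ≤_) left≡ (0≤right T)
    ; 0≤right = subst (0ℚ ≤_) right≡ (0≤left T)
    ; ≤left   = subst (Y ≤_) (cong₂ _*_ left≡ width≡) (≤right T)
    ; ≤right  = subst (Y ≤_) (cong₂ _*_ right≡ width≡) (≤left T)
    ; on      = flip-on (on T) }
    where
    left≡ : (- a + - a) - (- X) ≡ X - (a + a)
    left≡ = solve 2 (λ a X → (:- a :+ :- a) :- (:- X) := X :- (a :+ a)) refl a X
    right≡ : - X - (- b + - b) ≡ (b + b) - X
    right≡ = solve 2 (λ b X → :- X :- (:- b :+ :- b) := (b :+ b) :- X) refl b X
    width≡ : - a - (- b) ≡ b - a
    width≡ = solve 2 (λ a b → :- a :- (:- b) := b :- a) refl a b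
    flip-on : Y ≡ (- X - (- b + - b)) * (- a - (- b)) ⊎ Y ≡ ((- a + - a) - (- X)) * (- a - (- b)) →
              Y ≡ (X - (a + a)) * (b - a) ⊎ Y ≡ ((b + b) - X) * (b - a)
    flip-on (inj₁ eq) = inj₂ (trans eq (cong₂ _*_ right≡ width≡))
    flip-on (inj₂ eq) = inj₁ (trans eq (cong₂ _*_ left≡ width≡))

  falling : ∀ {a b τ X Y} → a < b → 0ℚ ≤ τ → τ ≤ 1ℚ →
            X ≡ (b + b) + τ * (a - b) → Y ≡ τ * ((a - b) * (a - b)) → Tent a b X Y
  falling {a} {b} {τ} a<b 0≤τ τ≤1 refl refl = mirror (rising (ℚₚ.neg-antimono-< a<b) 0≤τ τ≤1
    (solve 3 (λ a b τ → :- ((b :+ b) :+ τ :* (a :- b)) := (:- b :+ :- b) :+ τ :* (:- a :- (:- b))) refl a b τ)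
    (solve 3 (λ a b τ → τ :* ((a :- b) :* (a :- b)) := τ :* ((:- a :- (:- b)) :* (:- a :- (:- b)))) refl a b τ))

  AtEnd : (a b X Y : ℚ) → Set
  AtEnd a b X Y = (X ≡ a + a ⊎ X ≡ b + b) × Y ≡ 0ℚ

  end-left : ∀ {a b X Y} → Tent a b X Y → X ≡ a + a → AtEnd a b X Y
  end-left {a} {b} {X} {Y} T eq = inj₁ eq , ℚₚ.≤-antisym (subst (Y ≤_) zero≡ (≤left T)) (0≤Y T)
    where
    zero≡ : (X - (a + a)) * (b - a) ≡ 0ℚ
    zero≡ rewrite eq = trans (cong (_* (b - a)) (ℚₚ.+-inverseʳ (a + a))) (ℚₚ.*-zeroˡ (b - a))

  end-right : ∀ {a b X Y} → Tent a b X Y → X ≡ b + b → AtEnd a b X Y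
  end-right {a} {b} {X} {Y} T eq = inj₂ eq , ℚₚ.≤-antisym (subst (Y ≤_) zero≡ (≤right T)) (0≤Y T)
    where
    zero≡ : ((b + b) - X) * (b - a) ≡ 0ℚ
    zero≡ rewrite eq = trans (cong (_* (b - a)) (ℚₚ.+-inverseʳ (b + b))) (ℚₚ.*-zeroˡ (b - a))

  width≢0 : ∀ {a b} → a < b → b - a ≢ 0ℚ
  width≢0 a<b eq = ℚₚ.<-irrefl (sym eq) (<⇒0<- a<b)

  tent-ground : ∀ {a b X} → a < b → Tent a b X 0ℚ → X ≡ a + a ⊎ X ≡ b + b
  tent-ground a<b T with on T
  ... | inj₁ eq = inj₁ (-≡0⇒≡ (*≡0⇒≡0 (width≢0 a<b) (sym eq)))
  ... | inj₂ eq = inj₂ (sym (-≡0⇒≡ (*≡0⇒≡0 (width≢0 a<b) (sym eq))))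

  steeper⇒zero : ∀ {u W′ W} → 0ℚ ≤ u → W′ < W → u * W ≤ u * W′ → u ≡ 0ℚ
  steeper⇒zero {u} {W′} {W} 0≤u W′<W le with ℚₚ.<-cmp 0ℚ u
  ... | tri≈ _ 0≡u _ = sym 0≡u
  ... | tri> _ _ u<0 = contradiction (ℚₚ.≤-<-trans 0≤u u<0) (ℚₚ.<-irrefl refl)
  ... | tri< 0<u _ _ = contradiction
          (ℚₚ.≤-<-trans le (ℚₚ.*-monoʳ-<-pos u {{ℚ.positive 0<u}} W′<W)) (ℚₚ.<-irrefl refl)

  -- A point on a side of the outer tent has height u(b - a), where u is its distance to the foot of
  -- that side. Lying in the inner tent bounds the height by u(b′ - a′), and the inner slope is
  -- smaller, so u is 0.
  nested-tents : ∀ {a b a′ b′ X Y} → a ≤ a′ → b′ ≤ b → a′ < b′ → b′ - a′ < b - a →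
                 Tent a b X Y → Tent a′ b′ X Y → AtEnd a b X Y
  nested-tents {a} {b} {a′} {b′} {X} {Y} a≤a′ b′≤b a′<b′ W′<W T T′ with on T
  ... | inj₁ eq = end-left T (-≡0⇒≡ (steeper⇒zero (0≤left T) W′<W (begin
    (X - (a + a)) * (b - a)       ≡⟨ eq ⟨
    Y                             ≤⟨ ≤left T′ ⟩
    (X - (a′ + a′)) * (b′ - a′)   ≤⟨ ℚₚ.*-monoʳ-≤-nonNeg (b′ - a′) {{ℚ.nonNegative (ℚₚ.<⇒≤ (<⇒0<- a′<b′))}}
                                       (ℚₚ.+-monoʳ-≤ X (ℚₚ.neg-antimono-≤ (ℚₚ.+-mono-≤ a≤a′ a≤a′))) ⟩
    (X - (a + a)) * (b′ - a′)     ∎)))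
    where open ℚₚ.≤-Reasoning
  ... | inj₂ eq = end-right T (sym (-≡0⇒≡ (steeper⇒zero (0≤right T) W′<W (begin
    ((b + b) - X) * (b - a)       ≡⟨ eq ⟨
    Y                             ≤⟨ ≤right T′ ⟩
    ((b′ + b′) - X) * (b′ - a′)   ≤⟨ ℚₚ.*-monoʳ-≤-nonNeg (b′ - a′) {{ℚ.nonNegative (ℚₚ.<⇒≤ (<⇒0<- a′<b′))}}
                                       (ℚₚ.+-monoˡ-≤ (- X) (ℚₚ.+-mono-≤ b′≤b b′≤b)) ⟩
    ((b + b) - X) * (b′ - a′)     ∎))))
    where open ℚₚ.≤-Reasoning

  disjoint-tents : ∀ {a b a′ b′ X Y} → b ≤ a′ → Tent a b X Y → Tent a′ b′ X Y → AtEnd a b X Y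
  disjoint-tents {a} {b} {a′} {b′} {X} b≤a′ T T′ = end-right T (ℚₚ.≤-antisym (0≤-⇒≤ (0≤right T))
    (ℚₚ.≤-trans (ℚₚ.+-mono-≤ b≤a′ b≤a′) (0≤-⇒≤ (0≤left T′))))

  opposite-tents : ∀ {a b a′ b′ X Y} → a < b → Tent a b X Y → Tent a′ b′ X (- Y) → AtEnd a b X Y
  opposite-tents {a} {b} {X = X} {Y} a<b T T′ =
    tent-ground a<b (subst (Tent a b X) Y≡0 T) , Y≡0
    where
    Y≡0 : Y ≡ 0ℚ
    Y≡0 = ℚₚ.≤-antisym (0≤-⇒≤ (subst (0ℚ ≤_) (sym (ℚₚ.+-identityˡ (- Y))) (0≤Y T′))) (0≤Y T)

module Drawing {n : ℕ} (G : Graph n) (L : Layout G) where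
  open import Data.Rational using (_+_; _*_; _-_; -_; _≤_; _<_)
  open ℚ-Solver.+-*-Solver
  open Tents
  open Layout L

  embed : ℕ → ℚ
  embed zero    = 0ℚ
  embed (suc k) = 1ℚ + embed k

  x<1+x : ∀ x → x < 1ℚ + x
  x<1+x x = subst (_< 1ℚ + x) (ℚₚ.+-identityˡ x) (ℚₚ.+-monoˡ-< x (ℚₚ.positive⁻¹ 1ℚ))

  embed-< : ∀ {j k} → j ℕ.< k → embed j < embed k
  embed-< {j} {suc k} (s≤s j≤k) with ℕₚ.m≤n⇒m<n∨m≡n j≤k
  ... | inj₁ j<k  = ℚₚ.<-trans (embed-< j<k) (x<1+x (embed k))
  ... | inj₂ refl = x<1+x (embed j)

  h : Fin n → ℚ
  h u = embed (rank u)

  h-< : ∀ {u v} → rank u ℕ.< rank v → h u < h v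
  h-< = embed-<

  h-≤ : ∀ {u v} → rank u ℕ.≤ rank v → h u ≤ h v
  h-≤ le with ℕₚ.m≤n⇒m<n∨m≡n le
  ... | inj₁ lt = ℚₚ.<⇒≤ (embed-< lt)
  ... | inj₂ eq = ℚₚ.≤-reflexive (cong embed eq)

  h-injective : ∀ {u v} → h u ≡ h v → u ≡ v
  h-injective {u} {v} eq with ℕₚ.<-cmp (rank u) (rank v)
  ... | tri< lt _ _ = contradiction (embed-< lt) (ℚₚ.<-irrefl eq)
  ... | tri≈ _ r≡ _ = rank-injective u v r≡
  ... | tri> _ _ gt = contradiction (embed-< gt) (ℚₚ.<-irrefl (sym eq))

  side : Bool → ℚ → ℚ
  side true  y = y
  side false y = - y

  -- Abscissas are doubled so that the midpoint over an edge is `h u + h v`, without a division.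
  pos : Fin n → Point
  pos u = h u + h u , 0ℚ

  pos-injective : ∀ u v → pos u ≡ pos v → u ≡ v
  pos-injective u v eq = h-injective (double-injective (cong proj₁ eq))

  edgePage : Fin n → Fin n → Bool
  edgePage u v = if does (rank u ℕ.<? rank v) then page u v else page v u

  arc : Fin n → Fin n → PolyArc
  arc u v .PolyArc.len = 1
  arc u v .PolyArc.pt zero = pos u
  arc u v .PolyArc.pt (suc zero) = h u + h v , side (edgePage u v) ((h v - h u) * (h v - h u))
  arc u v .PolyArc.pt (suc (suc zero)) = pos v

  module _ {u v : Fin n} where

    abscissa₀ : ∀ t → (h u + h u) + t * ((h u + h v) - (h u + h u)) ≡ (h u + h u) + t * (h v - h u)
    abscissa₀ = solve 3 (λ p q t → (p :+ p) :+ t :* ((p :+ q) :- (p :+ p)) := (p :+ p) :+ t :* (q :- p)) refl (h u) (h v)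

    -- The second segment runs from the apex down to `v`; `1 - t` measures it from the foot, as
    -- `rising` and `falling` expect.
    abscissa₁ : ∀ t → (h u + h v) + t * ((h v + h v) - (h u + h v)) ≡ (h v + h v) + (1ℚ - t) * (h u - h v)
    abscissa₁ = solve 3 (λ p q t → (p :+ q) :+ t :* ((q :+ q) :- (p :+ q)) := (q :+ q) :+ (con 1ℚ :- t) :* (p :- q)) refl (h u) (h v)

    ordinate₀ : ∀ b t S → side b (0ℚ + t * (side b S - 0ℚ)) ≡ t * S
    ordinate₀ true  = solve 2 (λ t S → con 0ℚ :+ t :* (S :- con 0ℚ) := t :* S) refl
    ordinate₀ false = solve 2 (λ t S → :- (con 0ℚ :+ t :* (:- S :- con 0ℚ)) := t :* S) refl

    ordinate₁ : ∀ b t D D′ →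
      side b (side b ((D - D′) * (D - D′)) + t * (0ℚ - side b ((D - D′) * (D - D′))))
      ≡ (1ℚ - t) * ((D′ - D) * (D′ - D))
    ordinate₁ true  = solve 3 (λ t D D′ →
      (D :- D′) :* (D :- D′) :+ t :* (con 0ℚ :- (D :- D′) :* (D :- D′)) := (con 1ℚ :- t) :* ((D′ :- D) :* (D′ :- D))) refl
    ordinate₁ false = solve 3 (λ t D D′ →
      :- (:- ((D :- D′) :* (D :- D′)) :+ t :* (con 0ℚ :- :- ((D :- D′) :* (D :- D′)))) := (con 1ℚ :- t) :* ((D′ :- D) :* (D′ :- D))) refl

    0≤1-t : ∀ {t} → t ≤ 1ℚ → 0ℚ ≤ 1ℚ - t
    0≤1-t = ≤⇒0≤-

    1-t≤1 : ∀ {t} → 0ℚ ≤ t → 1ℚ - t ≤ 1ℚ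
    1-t≤1 {t} 0≤t = subst (1ℚ - t ≤_) (ℚₚ.+-identityʳ 1ℚ) (ℚₚ.+-monoʳ-≤ 1ℚ (ℚₚ.neg-antimono-≤ 0≤t))

    onArc⇒tent : rank u ℕ.< rank v → ∀ {X Y} → OnArc (arc u v) (X , Y) →
                 Tent (h u) (h v) X (side (edgePage u v) Y)
    onArc⇒tent u<v (zero , t , 0≤t , t≤1 , refl , refl) =
      rising (h-< u<v) 0≤t t≤1 (abscissa₀ t) (ordinate₀ (edgePage u v) t _)
    onArc⇒tent u<v (suc zero , t , 0≤t , t≤1 , refl , refl) =
      falling (h-< u<v) (0≤1-t t≤1) (1-t≤1 0≤t) (abscissa₁ t) (ordinate₁ (edgePage u v) t (h v) (h u))

    onArc⇒tentʳ : rank v ℕ.< rank u → ∀ {X Y} → OnArc (arc u v) (X , Y) →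
                  Tent (h v) (h u) X (side (edgePage u v) Y)
    onArc⇒tentʳ v<u (zero , t , 0≤t , t≤1 , refl , refl) =
      falling (h-< v<u) 0≤t t≤1 (abscissa₀ t) (ordinate₀ (edgePage u v) t _)
    onArc⇒tentʳ v<u (suc zero , t , 0≤t , t≤1 , refl , refl) =
      rising (h-< v<u) (0≤1-t t≤1) (1-t≤1 0≤t) (abscissa₁ t) (ordinate₁ (edgePage u v) t (h v) (h u))

    edgePage-< : rank u ℕ.< rank v → edgePage u v ≡ page u v
    edgePage-< u<v = cong (if_then page u v else page v u) (dec-true (rank u ℕ.<? rank v) u<v)

    edgePage-> : rank v ℕ.< rank u → edgePage u v ≡ page v u
    edgePage-> v<u = cong (if_then page u v else page v u) (dec-false (rank u ℕ.<? rank v) (ℕₚ.<-asym v<u))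

  -- `Planar` directs an edge by the indices of its ends, a layout by their ranks; this record
  -- passes from the first direction to the second.
  record Oriented (u v : Fin n) : Set where
    field
      l r   : Fin n
      ends  : (l ≡ u × r ≡ v) ⊎ (l ≡ v × r ≡ u)
      edge  : Edge G l r
      l<r   : rank l ℕ.< rank r
      tent  : ∀ {X Y} → OnArc (arc u v) (X , Y) → Tent (h l) (h r) X (side (page l r) Y)

  orient : ∀ {u v} → u <ᶠ v → Edge G u v → Oriented u v
  orient {u} {v} u<v e with ℕₚ.<-cmp (rank u) (rank v)
  ... | tri< lt _ _ = record { l = u ; r = v ; ends = inj₁ (refl , refl) ; edge = e ; l<r = lt
    ; tent = λ {X} {Y} on → subst (λ b → Tent (h u) (h v) X (side b Y)) (edgePage-< lt) (onArc⇒tent lt on) }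
  ... | tri≈ _ eq _ = contradiction (rank-injective u v eq) (Finₚ.<⇒≢ u<v)
  ... | tri> _ _ gt = record { l = v ; r = u ; ends = inj₂ (refl , refl) ; edge = trans (Graph.sym G v u) e ; l<r = gt
    ; tent = λ {X} {Y} on → subst (λ b → Tent (h v) (h u) X (side b Y)) (edgePage-> gt) (onArc⇒tentʳ gt on) }

  side-zero : ∀ b {y} → side b y ≡ 0ℚ → y ≡ 0ℚ
  side-zero true  eq = eq
  side-zero false {y} eq = trans (sym (solve 1 (λ y → :- (:- y) := y) refl y)) (cong -_ eq)

  side-0 : ∀ b → side b 0ℚ ≡ 0ℚ
  side-0 true  = refl
  side-0 false = refl

  module _ {u v : Fin n} (o : Oriented u v) where
    open Oriented o

    at-end : ∀ {X Y} → AtEnd (h l) (h r) X (side (page l r) Y) → Σ (Fin n) λ w → (X , Y) ≡ pos w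
    at-end (inj₁ eq , 0≡) = l , cong₂ _,_ eq (side-zero (page l r) 0≡)
    at-end (inj₂ eq , 0≡) = r , cong₂ _,_ eq (side-zero (page l r) 0≡)

    vertex-on-arc : ∀ w → OnArc (arc u v) (pos w) → (w ≡ u) ⊎ (w ≡ v)
    vertex-on-arc w on
      with tent-ground (h-< l<r) (subst (Tent (h l) (h r) (h w + h w)) (side-0 (page l r)) (tent on)) | ends
    ... | inj₁ eq | inj₁ (l≡u , _) = inj₁ (trans (h-injective (double-injective eq)) l≡u)
    ... | inj₁ eq | inj₂ (l≡v , _) = inj₂ (trans (h-injective (double-injective eq)) l≡v)
    ... | inj₂ eq | inj₁ (_ , r≡v) = inj₂ (trans (h-injective (double-injective eq)) r≡v)
    ... | inj₂ eq | inj₂ (_ , r≡u) = inj₁ (trans (h-injective (double-injective eq)) r≡u)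

  narrower : ∀ {a b a′ b′} → a ≤ a′ → b′ < b → b′ - a′ < b - a
  narrower a≤a′ b′<b = ℚₚ.+-mono-<-≤ b′<b (ℚₚ.neg-antimono-≤ a≤a′)

  narrower′ : ∀ {a b a′ b′} → a < a′ → b′ ≤ b → b′ - a′ < b - a
  narrower′ a<a′ b′≤b = ℚₚ.+-mono-≤-< b′≤b (ℚₚ.neg-antimono-< a<a′)

  data Position (l r l′ r′ : Fin n) : Set where
    left-of  : h r ≤ h l′ → Position l r l′ r′
    right-of : h r′ ≤ h l → Position l r l′ r′
    around   : h l ≤ h l′ → h r′ ≤ h r → h r′ - h l′ < h r - h l → Position l r l′ r′
    within   : h l′ ≤ h l → h r ≤ h r′ → h r - h l < h r′ - h l′ → Position l r l′ r′

  -- Noncrossing leaves two intervals disjoint or nested. If they are nested and the edges differ,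
  -- at least one end differs, which gives the strict inequality of widths that `nested-tents`
  -- needs.
  position : ∀ {l r l′ r′} → Edge G l r → Edge G l′ r′ → page l r ≡ page l′ r′ →
             ¬ (l ≡ l′ × r ≡ r′) → Position l r l′ r′
  position {l} {r} {l′} {r′} e e′ same distinct-edges with ℕₚ.<-cmp (rank l) (rank l′)
  ... | tri< l<l′ _ _ with rank l′ ℕ.<? rank r | rank r ℕ.<? rank r′
  ...   | no l′≮r | _        = left-of (h-≤ (ℕₚ.≮⇒≥ l′≮r))
  ...   | yes l′<r | yes r<r′ = ⊥-elim (noncrossing e e′ same l<l′ l′<r r<r′)
  ...   | yes _    | no r≮r′  = around (ℚₚ.<⇒≤ (h-< l<l′)) (h-≤ (ℕₚ.≮⇒≥ r≮r′)) (narrower′ (h-< l<l′) (h-≤ (ℕₚ.≮⇒≥ r≮r′)))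
  position {l} {r} {l′} {r′} e e′ same distinct-edges | tri> _ _ l′<l with rank l ℕ.<? rank r′ | rank r′ ℕ.<? rank r
  ...   | no l≮r′  | _        = right-of (h-≤ (ℕₚ.≮⇒≥ l≮r′))
  ...   | yes l<r′ | yes r′<r = ⊥-elim (noncrossing e′ e (sym same) l′<l l<r′ r′<r)
  ...   | yes _    | no r′≮r  = within (ℚₚ.<⇒≤ (h-< l′<l)) (h-≤ (ℕₚ.≮⇒≥ r′≮r)) (narrower′ (h-< l′<l) (h-≤ (ℕₚ.≮⇒≥ r′≮r)))
  position {l} {r} {l′} {r′} e e′ same distinct-edges | tri≈ _ l≡l′ _ with ℕₚ.<-cmp (rank r) (rank r′)
  ...   | tri< r<r′ _ _ = within l′≤l (ℚₚ.<⇒≤ (h-< r<r′)) (narrower l′≤l (h-< r<r′))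
    where l′≤l = h-≤ (ℕₚ.≤-reflexive (sym l≡l′))
  ...   | tri≈ _ r≡r′ _ = contradiction (rank-injective l l′ l≡l′ , rank-injective r r′ r≡r′) distinct-edges
  ...   | tri> _ _ r′<r = around l≤l′ (ℚₚ.<⇒≤ (h-< r′<r)) (narrower l≤l′ (h-< r′<r))
    where l≤l′ = h-≤ (ℕₚ.≤-reflexive l≡l′)

  same-ends : ∀ {u v x y} (o : Oriented u v) (o′ : Oriented x y) → u <ᶠ v → x <ᶠ y →
              Oriented.l o ≡ Oriented.l o′ → Oriented.r o ≡ Oriented.r o′ → (u ≡ x) × (v ≡ y)
  same-ends o o′ u<v x<y l≡ r≡ with Oriented.ends o | Oriented.ends o′
  ... | inj₁ (refl , refl) | inj₁ (refl , refl) = l≡ , r≡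
  ... | inj₂ (refl , refl) | inj₂ (refl , refl) = r≡ , l≡
  ... | inj₁ (refl , refl) | inj₂ (refl , refl) with refl ← l≡ | refl ← r≡ = contradiction x<y (ℕₚ.<-asym u<v)
  ... | inj₂ (refl , refl) | inj₁ (refl , refl) with refl ← l≡ | refl ← r≡ = contradiction x<y (ℕₚ.<-asym u<v)

  arcs-meet : ∀ {u v x y} (o : Oriented u v) (o′ : Oriented x y) →
              ¬ (Oriented.l o ≡ Oriented.l o′ × Oriented.r o ≡ Oriented.r o′) →
              ∀ {X Y} → OnArc (arc u v) (X , Y) → OnArc (arc x y) (X , Y) → Σ (Fin n) λ w → (X , Y) ≡ pos w
  arcs-meet o o′ differ {X} {Y} on on′ = meet (tent on) (tent′ on′)
    where
    open Oriented o
    open Oriented o′ renaming (l to l′; r to r′; ends to ends′; edge to edge′; l<r to l′<r′; tent to tent′)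
    meet : Tent (h l) (h r) X (side (page l r) Y) →
           Tent (h l′) (h r′) X (side (page l′ r′) Y) → Σ (Fin n) λ w → (X , Y) ≡ pos w
    meet T T′ with page l r Boolₚ.≟ page l′ r′
    meet T T′ | yes same with position edge edge′ same differ
    ... | left-of r≤l′      = at-end o (disjoint-tents r≤l′ T (subst (λ b → Tent (h l′) (h r′) X (side b Y)) (sym same) T′))
    ... | right-of r′≤l     = at-end o′ (disjoint-tents r′≤l T′ (subst (λ b → Tent (h l) (h r) X (side b Y)) same T))
    ... | around l≤ r≤ lt   = at-end o (nested-tents l≤ r≤ (h-< l′<r′) lt T (subst (λ b → Tent (h l′) (h r′) X (side b Y)) (sym same) T′))
    ... | within l≤ r≤ lt   = at-end o′ (nested-tents l≤ r≤ (h-< l<r) lt T′ (subst (λ b → Tent (h l) (h r) X (side b Y)) same T))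
    meet T T′ | no opposite = at-end o (opposite-tents (h-< l<r) T
      (subst (Tent (h l′) (h r′) X) (other-side (page l r) (page l′ r′) opposite) T′))
      where
      other-side : ∀ b b′ → b ≢ b′ → side b′ Y ≡ - side b Y
      other-side true  true  b≢b′ = contradiction refl b≢b′
      other-side false false b≢b′ = contradiction refl b≢b′
      other-side true  false _    = refl
      other-side false true  _    = sym (solve 1 (λ y → :- (:- y) := y) refl Y)

  -- The abscissa alone determines the parameter: it moves at the nonzero rate `h v - h u` with `t`
  -- on the first segment and with `1 + t` on the second, so the segments can share only the apex.
  simple : ∀ {u v} → u <ᶠ v → SimpleArc (arc u v)
  simple {u} {v} u<v = go
    where
    D≢0 : h v - h u ≢ 0ℚ
    D≢0 eq = Finₚ.<⇒≢ u<v (sym (h-injective (-≡0⇒≡ eq)))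
    solve-first : ∀ t s → (h u + h u) + t * (h v - h u) ≡ (h u + h u) + s * (h v - h u) → t ≡ s
    solve-first t s eq = *-cancelʳ D≢0 (+-cancelˡ (h u + h u) _ _ eq)
    first second : ℚ → ℚ
    first  t = (h u + h u) + t * ((h u + h v) - (h u + h u))
    second t = (h u + h v) + t * ((h v + h v) - (h u + h v))
    first≡ : ∀ t → first t ≡ (h u + h u) + t * (h v - h u)
    first≡ = abscissa₀ {u} {v}
    second≡ : ∀ t → second t ≡ (h u + h u) + (1ℚ + t) * (h v - h u)
    second≡ = solve 3 (λ p q t → (p :+ q) :+ t :* ((q :+ q) :- (p :+ q)) := (p :+ p) :+ (con 1ℚ :+ t) :* (q :- p)) refl (h u) (h v)
    corner : ∀ t s → t ≤ 1ℚ → 0ℚ ≤ s → first t ≡ second s → (t ≡ 1ℚ) × (s ≡ 0ℚ)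
    corner t s t≤1 0≤s eq = trans t≡1+s (trans (cong (1ℚ +_) s≡0) (ℚₚ.+-identityʳ 1ℚ)) , s≡0
      where
      t≡1+s : t ≡ 1ℚ + s
      t≡1+s = solve-first t (1ℚ + s) (trans (sym (first≡ t)) (trans eq (second≡ s)))
      s≡0 : s ≡ 0ℚ
      s≡0 = ℚₚ.≤-antisym (0≤-⇒≤ (subst (0ℚ ≤_) (trans (cong (λ x → 1ℚ - x) t≡1+s)
              (solve 1 (λ s → con 1ℚ :- (con 1ℚ :+ s) := con 0ℚ :- s) refl s)) (≤⇒0≤- t≤1))) 0≤s
    go : SimpleArc (arc u v)
    go zero zero t s X (_ , _ , x₁ , _) (_ , _ , x₂ , _) =
      inj₁ (refl , solve-first t s (trans (sym (first≡ t)) (trans (trans (sym x₁) x₂) (first≡ s))))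
    go (suc zero) (suc zero) t s X (_ , _ , x₁ , _) (_ , _ , x₂ , _) =
      inj₁ (refl , +-cancelˡ 1ℚ t s
        (solve-first (1ℚ + t) (1ℚ + s) (trans (sym (second≡ t)) (trans (trans (sym x₁) x₂) (second≡ s)))))
    go zero (suc zero) t s X (_ , t≤1 , x₁ , _) (0≤s , _ , x₂ , _) =
      inj₂ (inj₁ (refl , corner t s t≤1 0≤s (trans (sym x₁) x₂)))
    go (suc zero) zero t s X (0≤t , _ , x₁ , _) (_ , s≤1 , x₂ , _) =
      inj₂ (inj₂ (refl , corner s t s≤1 0≤t (trans (sym x₂) x₁)))

  planar : Planar G
  planar = pos , arc , pos-injective
    , (λ u v u<v e → simple u<v , refl , refl)
    , (λ u v w u<v e → vertex-on-arc (orient u<v e) w)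
    , (λ u v x y u<v x<y e e′ differ X on on′ →
        arcs-meet (orient u<v e) (orient x<y e′)
          (λ (l≡ , r≡) → differ (same-ends (orient u<v e) (orient x<y e′) u<v x<y l≡ r≡)) on on′)

open import Data.Nat using (_+_; _*_; _≤_; _<_)

-- Counting occurrences

module _ {n : ℕ} where

  δ : Fin n → Fin n → ℕ
  δ z x = if does (z Fin.≟ x) then 1 else 0

  count : Fin n → List (Fin n) → ℕ
  count z []       = 0
  count z (x ∷ xs) = δ z x + count z xs

  -- Multiplicities add over `++` and ignore `reverse`, so cutting up and rearranging a list becomes
  -- arithmetic.
  record Distinct (xs : List (Fin n)) : Set where
    constructor distinct
    field count≤1 : ∀ z → count z xs ≤ 1
  open Distinct

  δ-refl : ∀ x → δ x x ≡ 1
  δ-refl x with x Fin.≟ x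
  ... | yes _  = refl
  ... | no x≢x = contradiction refl x≢x

  δ-≢ : ∀ {z x} → z ≢ x → δ z x ≡ 0
  δ-≢ {z} {x} z≢x with z Fin.≟ x
  ... | yes z≡x = contradiction z≡x z≢x
  ... | no _    = refl

  count-++ : ∀ z xs ys → count z (xs ++ ys) ≡ count z xs + count z ys
  count-++ z []       ys = refl
  count-++ z (x ∷ xs) ys =
    trans (cong (δ z x +_) (count-++ z xs ys)) (sym (ℕₚ.+-assoc (δ z x) _ _))

  count-reverse : ∀ z xs → count z (reverse xs) ≡ count z xs
  count-reverse z []       = refl
  count-reverse z (x ∷ xs) = begin
    count z (reverse (x ∷ xs))          ≡⟨ cong (count z) (Listₚ.unfold-reverse x xs) ⟩
    count z (reverse xs ++ [ x ])       ≡⟨ count-++ z (reverse xs) [ x ] ⟩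
    count z (reverse xs) + (δ z x + 0)  ≡⟨ cong₂ _+_ (count-reverse z xs) (ℕₚ.+-identityʳ _) ⟩
    count z xs + δ z x                  ≡⟨ ℕₚ.+-comm (count z xs) _ ⟩
    δ z x + count z xs                  ∎
    where open ≡-Reasoning

  ∈⇒count : ∀ {z xs} → z ∈ xs → 1 ≤ count z xs
  ∈⇒count {z} (here refl)            rewrite δ-refl z = s≤s z≤n
  ∈⇒count {z} {x ∷ xs} (there z∈xs) = ℕₚ.≤-trans (∈⇒count z∈xs) (ℕₚ.m≤n+m _ (δ z x))

  ∉⇒count : ∀ {z xs} → ¬ z ∈ xs → count z xs ≡ 0
  ∉⇒count {z} {[]}     _    = refl
  ∉⇒count {z} {x ∷ xs} z∉ =
    cong₂ _+_ (δ-≢ (z∉ ∘ here)) (∉⇒count (z∉ ∘ there))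

  Distinct-tail : ∀ {x xs} → Distinct (x ∷ xs) → Distinct xs
  Distinct-tail {x} d = distinct λ z → ℕₚ.≤-trans (ℕₚ.m≤n+m _ (δ z x)) (count≤1 d z)

  Distinct-head : ∀ {x xs} → Distinct (x ∷ xs) → ∀ {z} → z ∈ xs → x ≢ z
  Distinct-head {x} {xs} d z∈xs refl
    with s≤s () ← ℕₚ.≤-trans (ℕₚ.+-mono-≤ (ℕₚ.≤-reflexive (sym (δ-refl x))) (∈⇒count z∈xs)) (count≤1 d x)

  Distinct-∷ : ∀ {x xs} → ¬ x ∈ xs → Distinct xs → Distinct (x ∷ xs)
  Distinct-∷ {x} {xs} x∉xs d = distinct bound
    where
    bound : ∀ z → count z (x ∷ xs) ≤ 1
    bound z with z Fin.≟ x
    ... | yes refl = ℕₚ.≤-reflexive (cong suc (∉⇒count x∉xs))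
    ... | no _     = count≤1 d z

  lookup-injective : ∀ {xs} → Distinct xs → ∀ i j → lookup xs i ≡ lookup xs j → i ≡ j
  lookup-injective {x ∷ xs} d zero    zero    _  = refl
  lookup-injective {x ∷ xs} d zero    (suc j) eq =
    contradiction eq (Distinct-head d (lookup∈ xs j))
    where
    lookup∈ : ∀ ys k → lookup ys k ∈ ys
    lookup∈ (y ∷ ys) zero    = here refl
    lookup∈ (y ∷ ys) (suc k) = there (lookup∈ ys k)
  lookup-injective {x ∷ xs} d (suc i) zero    eq =
    sym (lookup-injective {x ∷ xs} d zero (suc i) (sym eq))
  lookup-injective {x ∷ xs} d (suc i) (suc j) eq =
    cong suc (lookup-injective {xs} (Distinct-tail {x} {xs} d) i j eq)

  Distinct⇒length≤ : ∀ {xs} → Distinct xs → length xs ≤ n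
  Distinct⇒length≤ {xs} d with length xs ℕ.≤? n
  ... | yes le = le
  ... | no ≰n with i , j , i<j , eq ← Finₚ.pigeonhole (ℕₚ.≰⇒> ≰n) (lookup xs) =
    contradiction (lookup-injective d i j eq) (Finₚ.<⇒≢ i<j)

-- Distinctness of a list built from segments of a distinct list is decided by
-- comparing how often each segment occurs, so it is proved by reflection.
infixr 5 _⊕_
data Expr (m : ℕ) : Set where
  seg : Fin m → Expr m
  _⊕_ : Expr m → Expr m → Expr m
  rev : Expr m → Expr m

module _ {m : ℕ} where

  uses : Expr m → Fin m → ℕ
  uses (seg i) j = if does (i Fin.≟ j) then 1 else 0
  uses (e ⊕ f) j = uses e j + uses f j
  uses (rev e) j = uses e j

  ∑ : ∀ {k} → (Fin k → ℕ) → ℕ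
  ∑ {zero}  f = 0
  ∑ {suc k} f = f zero + ∑ (f ∘ suc)

  ∑-mono : ∀ {k} (f g : Fin k → ℕ) → (∀ i → f i ≤ g i) → ∑ f ≤ ∑ g
  ∑-mono {zero}  f g f≤g = z≤n
  ∑-mono {suc k} f g f≤g = ℕₚ.+-mono-≤ (f≤g zero) (∑-mono (f ∘ suc) (g ∘ suc) (f≤g ∘ suc))

  ∑-cong : ∀ {k} {f g : Fin k → ℕ} → (∀ i → f i ≡ g i) → ∑ f ≡ ∑ g
  ∑-cong {zero}  f≡g = refl
  ∑-cong {suc k} f≡g = cong₂ _+_ (f≡g zero) (∑-cong (f≡g ∘ suc))

  ∑-zero : ∀ k → ∑ {k} (λ _ → 0) ≡ 0
  ∑-zero zero    = refl
  ∑-zero (suc k) = ∑-zero k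

  ∑-+ : ∀ {k} (f g : Fin k → ℕ) → ∑ (λ i → f i + g i) ≡ ∑ f + ∑ g
  ∑-+ {zero}  f g = refl
  ∑-+ {suc k} f g rewrite ∑-+ (f ∘ suc) (g ∘ suc) =
    solve 4 (λ a b c d → (a :+ b) :+ (c :+ d) := (a :+ c) :+ (b :+ d)) refl
      (f zero) (g zero) (∑ (f ∘ suc)) (∑ (g ∘ suc))
    where open +-*-Solver

  ∑-unit : ∀ {k} (i : Fin k) (f : Fin k → ℕ) →
           ∑ (λ j → (if does (i Fin.≟ j) then 1 else 0) * f j) ≡ f i
  ∑-unit {suc k} zero    f =
    trans (cong₂ _+_ (ℕₚ.+-identityʳ (f zero)) (∑-zero k)) (ℕₚ.+-identityʳ (f zero))
  ∑-unit {suc k} (suc i) f = ∑-unit i (f ∘ suc)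

  module _ {n : ℕ} (ρ : Vec (List (Fin n)) m) where

    ⟦_⟧ : Expr m → List (Fin n)
    ⟦ seg i ⟧ = Vec.lookup ρ i
    ⟦ e ⊕ f ⟧ = ⟦ e ⟧ ++ ⟦ f ⟧
    ⟦ rev e ⟧ = reverse ⟦ e ⟧

    -- Instantiated with `count z`, which transports distinctness, and with `length`, which
    -- transports the bounds for the path argument.
    module Additive (μ : List (Fin n) → ℕ)
                    (μ-++ : ∀ xs ys → μ (xs ++ ys) ≡ μ xs + μ ys)
                    (μ-reverse : ∀ xs → μ (reverse xs) ≡ μ xs) where
      open ≡-Reasoning

      μ-⟦⟧ : ∀ e → μ ⟦ e ⟧ ≡ ∑ (λ i → uses e i * μ (Vec.lookup ρ i))
      μ-⟦⟧ (seg i) = sym (∑-unit i (λ j → μ (Vec.lookup ρ j)))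
      μ-⟦⟧ (e ⊕ f) = begin
        μ (⟦ e ⟧ ++ ⟦ f ⟧)                            ≡⟨ μ-++ ⟦ e ⟧ ⟦ f ⟧ ⟩
        μ ⟦ e ⟧ + μ ⟦ f ⟧                             ≡⟨ cong₂ _+_ (μ-⟦⟧ e) (μ-⟦⟧ f) ⟩
        ∑ (λ i → uses e i * c i) + ∑ (λ i → uses f i * c i)
          ≡⟨ ∑-+ (λ i → uses e i * c i) (λ i → uses f i * c i) ⟨
        ∑ (λ i → uses e i * c i + uses f i * c i)
          ≡⟨ ∑-cong (λ i → ℕₚ.*-distribʳ-+ (c i) (uses e i) (uses f i)) ⟨
        ∑ (λ i → (uses e i + uses f i) * c i)         ∎
        where
        c : Fin m → ℕ
        c i = μ (Vec.lookup ρ i)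
      μ-⟦⟧ (rev e) = trans (μ-reverse ⟦ e ⟧) (μ-⟦⟧ e)

      μ-mono : ∀ e f → (∀ i → uses e i ≤ uses f i) → μ ⟦ e ⟧ ≤ μ ⟦ f ⟧
      μ-mono e f e≤f = ℕₚ.≤-trans (ℕₚ.≤-reflexive (μ-⟦⟧ e)) (ℕₚ.≤-trans
        (∑-mono _ _ (λ i → ℕₚ.*-monoˡ-≤ (μ (Vec.lookup ρ i)) (e≤f i)))
        (ℕₚ.≤-reflexive (sym (μ-⟦⟧ f))))

    Distinct-sub : ∀ e f {_ : True (Finₚ.all? (λ i → uses f i ℕ.≤? uses e i))} →
                   Distinct ⟦ e ⟧ → Distinct ⟦ f ⟧
    Distinct-sub e f {f≤e} d = distinct λ z → ℕₚ.≤-trans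
      (Additive.μ-mono (count z) (count-++ z) (count-reverse z) f e (toWitness f≤e)) (Distinct.count≤1 d z)

    length-sub : ∀ e f {_ : True (Finₚ.all? (λ i → uses e i ℕ.≤? uses f i))} →
                 length ⟦ e ⟧ ≤ length ⟦ f ⟧
    length-sub e f {e≤f} = Additive.μ-mono length (λ xs ys → Listₚ.length-++ xs) Listₚ.length-reverse
      e f (toWitness e≤f)

-- Weights of the six edges of K₄

Admissible : ℕ → Set
Admissible k = (k % 4 ≡ 1) ⊎ (k % 4 ≡ 2)

module _ where
  open ≡-Reasoning

  admissibleᵇ : ℕ → Bool
  admissibleᵇ k = (k % 4 ℕ.≡ᵇ 1) ∨ (k % 4 ℕ.≡ᵇ 2)

  Admissible⇒admissibleᵇ : ∀ {k} → Admissible k → admissibleᵇ k ≡ true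
  Admissible⇒admissibleᵇ {k} (inj₁ eq) rewrite eq = refl
  Admissible⇒admissibleᵇ {k} (inj₂ eq) rewrite eq = refl

  %-sum₃ : ∀ a b c → (a % 4 + b % 4 + c % 4) % 4 ≡ (a + b + c) % 4
  %-sum₃ a b c = begin
    (a % 4 + b % 4 + c % 4) % 4              ≡⟨ %-distribˡ-+ (a % 4 + b % 4) (c % 4) 4 ⟩
    ((a % 4 + b % 4) % 4 + c % 4 % 4) % 4    ≡⟨ cong₂ (λ x y → (x + y) % 4) (sym (%-distribˡ-+ a b 4)) (m%n%n≡m%n c 4) ⟩
    ((a + b) % 4 + c % 4) % 4                ≡⟨ %-distribˡ-+ (a + b) c 4 ⟨
    (a + b + c) % 4                          ∎

  %-sum₄ : ∀ a b c d → (a % 4 + b % 4 + c % 4 + d % 4) % 4 ≡ (a + b + c + d) % 4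
  %-sum₄ a b c d = begin
    (a % 4 + b % 4 + c % 4 + d % 4) % 4              ≡⟨ %-distribˡ-+ (a % 4 + b % 4 + c % 4) (d % 4) 4 ⟩
    ((a % 4 + b % 4 + c % 4) % 4 + d % 4 % 4) % 4    ≡⟨ cong₂ (λ x y → (x + y) % 4) (%-sum₃ a b c) (m%n%n≡m%n d 4) ⟩
    ((a + b + c) % 4 + d % 4) % 4                    ≡⟨ %-distribˡ-+ (a + b + c) d 4 ⟨
    (a + b + c + d) % 4                              ∎

  admissibleᵇ-% : ∀ j k → j % 4 ≡ k % 4 → Admissible k → admissibleᵇ j ≡ true
  admissibleᵇ-% j k eq adm =
    Admissible⇒admissibleᵇ {j} (subst (λ r → (r ≡ 1) ⊎ (r ≡ 2)) (sym eq) adm)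

  sum₃ : ∀ a b c → Admissible (a + b + c) → admissibleᵇ (a % 4 + b % 4 + c % 4) ≡ true
  sum₃ a b c = admissibleᵇ-% (a % 4 + b % 4 + c % 4) (a + b + c) (%-sum₃ a b c)

  sum₄ : ∀ a b c d → Admissible (a + b + c + d) → admissibleᵇ (a % 4 + b % 4 + c % 4 + d % 4) ≡ true
  sum₄ a b c d = admissibleᵇ-% (a % 4 + b % 4 + c % 4 + d % 4) (a + b + c + d) (%-sum₄ a b c d)

  -- A quantifier over residues that computes, so that nesting it six times leaves a closed Boolean
  -- for `refl`.
  every<4 : (ℕ → Bool) → Bool
  every<4 f = f 0 ∧ f 1 ∧ f 2 ∧ f 3

  every<4-sound : ∀ f → every<4 f ≡ true → ∀ k → f (k % 4) ≡ true
  every<4-sound f eq k = aux (k % 4) (m%n<n k 4) eq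
    where
    aux : ∀ r → r < 4 → f 0 ∧ f 1 ∧ f 2 ∧ f 3 ≡ true → f r ≡ true
    aux r r<4 eq with f 0 in e₀ | f 1 in e₁ | f 2 in e₂ | f 3 in e₃
    aux 0 _ refl | true | true | true | true = e₀
    aux 1 _ refl | true | true | true | true = e₁
    aux 2 _ refl | true | true | true | true = e₂
    aux 3 _ refl | true | true | true | true = e₃
    aux (suc (suc (suc (suc _)))) (s≤s (s≤s (s≤s (s≤s ())))) _ | _ | _ | _ | _

  -- Arguments: the weights of ab, ac, ad, bc, bd, cd; the conjuncts are the
  -- four triangles and three quadrilaterals of K₄.
  k4-cyclesᵇ : (p q r s t o : ℕ) → Bool
  k4-cyclesᵇ p q r s t o =
      admissibleᵇ (p + s + q) ∧ admissibleᵇ (p + t + r)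
    ∧ admissibleᵇ (q + o + r) ∧ admissibleᵇ (s + o + t)
    ∧ admissibleᵇ (p + s + o + r) ∧ admissibleᵇ (p + t + o + q) ∧ admissibleᵇ (q + s + t + r)

  -- All 4⁶ residue vectors are evaluated. Behind this is a parity argument: two triangles sharing
  -- an edge e bound a quadrilateral of weight T + T′ - 2e. If the triangles and quadrilaterals are
  -- all 1 or 2 modulo 4, this forces e to be even exactly when T and T′ are both odd. The four
  -- triangles sum to twice the total weight, so 0, 2 or 4 of them are odd. With none odd, all edges
  -- are odd and so are the triangles; with four odd, all edges are even and so are the triangles;
  -- with two odd, an odd triangle has one even and two odd edges. Each case is absurd.
  k4-cyclesᵇ-false : ∀ p q r s t o →
    not (k4-cyclesᵇ (p % 4) (q % 4) (r % 4) (s % 4) (t % 4) (o % 4)) ≡ true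
  k4-cyclesᵇ-false p q r s t o =
    every<4-sound (λ o → not (k4-cyclesᵇ (p % 4) (q % 4) (r % 4) (s % 4) (t % 4) o))
    (every<4-sound (λ t → every<4 λ o → not (k4-cyclesᵇ (p % 4) (q % 4) (r % 4) (s % 4) t o))
    (every<4-sound (λ s → every<4 λ t → every<4 λ o → not (k4-cyclesᵇ (p % 4) (q % 4) (r % 4) s t o))
    (every<4-sound (λ r → every<4 λ s → every<4 λ t → every<4 λ o → not (k4-cyclesᵇ (p % 4) (q % 4) r s t o))
    (every<4-sound (λ q → every<4 λ r → every<4 λ s → every<4 λ t → every<4 λ o → not (k4-cyclesᵇ (p % 4) q r s t o))
    (every<4-sound (λ p → every<4 λ q → every<4 λ r → every<4 λ s → every<4 λ t → every<4 λ o → not (k4-cyclesᵇ p q r s t o))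
    refl p) q) r) s) t) o

  k4-not-admissible : ∀ p q r s t o →
    Admissible (p + s + q) → Admissible (p + t + r) → Admissible (q + o + r) → Admissible (s + o + t) →
    Admissible (p + s + o + r) → Admissible (p + t + o + q) → Admissible (q + s + t + r) → ⊥
  k4-not-admissible p q r s t o c₁ c₂ c₃ c₄ c₅ c₆ c₇ =
    contradiction (trans (sym (k4-cyclesᵇ-false p q r s t o)) (cong not all-true)) λ ()
    where
    all-true : k4-cyclesᵇ (p % 4) (q % 4) (r % 4) (s % 4) (t % 4) (o % 4) ≡ true
    all-true =
      cong₂ _∧_ (sum₃ p s q c₁) (cong₂ _∧_ (sum₃ p t r c₂)
      (cong₂ _∧_ (sum₃ q o r c₃) (cong₂ _∧_ (sum₃ s o t c₄)
      (cong₂ _∧_ (sum₄ p s o r c₅) (cong₂ _∧_ (sum₄ p t o q c₆) (sum₄ q s t r c₇))))))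

-- Walks and cycle weights

module Weighted {n : ℕ} (G : Graph n) (wt : Fin n → Fin n → ℕ)
                (wt-sym : ∀ u v → wt u v ≡ wt v u) where
  Edge-sym : ∀ {u v} → Edge G u v → Edge G v u
  Edge-sym {u} {v} e = trans (Graph.sym G v u) e

  Edge-irrefl : ∀ {u v} → Edge G u v → u ≢ v
  Edge-irrefl {u} e refl with () ← trans (sym e) (Graph.irrefl G u)

  -- The list holds the interior vertices only.
  Walk : Fin n → List (Fin n) → Fin n → Set
  Walk u []       v = Edge G u v
  Walk u (x ∷ xs) v = Edge G u x × Walk x xs v

  weight : Fin n → List (Fin n) → Fin n → ℕ
  weight u []       v = wt u v
  weight u (x ∷ xs) v = wt u x + weight x xs v

  Walk-++ : ∀ {u x v} xs {ys} → Walk u xs x → Walk x ys v → Walk u (xs ++ x ∷ ys) v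
  Walk-++ []       e       q = e , q
  Walk-++ (_ ∷ xs) (e , p) q = e , Walk-++ xs p q

  weight-++ : ∀ u xs x ys v → weight u (xs ++ x ∷ ys) v ≡ weight u xs x + weight x ys v
  weight-++ u []       x ys v = refl
  weight-++ u (y ∷ xs) x ys v =
    trans (cong (wt u y +_) (weight-++ y xs x ys v)) (sym (ℕₚ.+-assoc (wt u y) _ _))

  Walk-split : ∀ {u x v} xs {ys} → Walk u (xs ++ x ∷ ys) v → Walk u xs x × Walk x ys v
  Walk-split []       (e , q) = e , q
  Walk-split (_ ∷ xs) (e , p) with p₁ , p₂ ← Walk-split xs p = (e , p₁) , p₂

  Walk-reverse : ∀ {u v} xs → Walk u xs v → Walk v (reverse xs) u
  Walk-reverse         []       e       = Edge-sym e
  Walk-reverse {u} {v} (x ∷ xs) (e , p) =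
    subst (λ ys → Walk v ys u) (sym (Listₚ.unfold-reverse x xs))
      (Walk-++ (reverse xs) (Walk-reverse xs p) (Edge-sym e))

  weight-reverse : ∀ u xs v → weight v (reverse xs) u ≡ weight u xs v
  weight-reverse u []       v = wt-sym v u
  weight-reverse u (x ∷ xs) v = begin
    weight v (reverse (x ∷ xs)) u          ≡⟨ cong (λ ys → weight v ys u) (Listₚ.unfold-reverse x xs) ⟩
    weight v (reverse xs ++ x ∷ []) u      ≡⟨ weight-++ v (reverse xs) x [] u ⟩
    weight v (reverse xs) x + wt x u       ≡⟨ cong₂ _+_ (weight-reverse x xs v) (wt-sym x u) ⟩
    weight x xs v + wt u x                 ≡⟨ ℕₚ.+-comm _ (wt u x) ⟩
    wt u x + weight x xs v                 ∎
    where open ≡-Reasoning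

  -- With a single interior vertex the closed walk would only go to and fro along one edge; the
  -- bound 2 excludes this.
  CyclesAdmissible : Set
  CyclesAdmissible = ∀ u xs → 2 ≤ length xs → Walk u xs u → Distinct (u ∷ xs) → Admissible (weight u xs u)

-- Exclusion of K₄ subdivisions

module _ {n : ℕ} (G : Graph n) (wt : Fin n → Fin n → ℕ)
         (wt-sym : ∀ u v → wt u v ≡ wt v u) where
  open Weighted G wt wt-sym

  module _ (adm : CyclesAdmissible) where

    triangle : ∀ {a b c} X Y Z → Walk a X b → Walk b Y c → Walk c Z a →
               Distinct (a ∷ X ++ b ∷ Y ++ c ∷ Z) →
               Admissible (weight a X b + weight b Y c + weight c Z a)
    triangle {a} {b} {c} X Y Z p q r d = subst Admissible weight≡
      (adm a (X ++ b ∷ Y ++ c ∷ Z) (2≤ X Y) (Walk-++ X p (Walk-++ Y q r)) d)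
      where
      1≤ : ∀ (Y : List (Fin n)) → 1 ≤ length (Y ++ c ∷ Z)
      1≤ []      = s≤s z≤n
      1≤ (_ ∷ Y) = s≤s z≤n
      2≤ : ∀ (X Y : List (Fin n)) → 2 ≤ length (X ++ b ∷ Y ++ c ∷ Z)
      2≤ []      Y = s≤s (1≤ Y)
      2≤ (_ ∷ X) Y = ℕₚ.≤-trans (2≤ X Y) (ℕₚ.n≤1+n _)
      weight≡ : weight a (X ++ b ∷ Y ++ c ∷ Z) a ≡ weight a X b + weight b Y c + weight c Z a
      weight≡ = begin
        weight a (X ++ b ∷ Y ++ c ∷ Z) a                 ≡⟨ weight-++ a X b (Y ++ c ∷ Z) a ⟩
        weight a X b + weight b (Y ++ c ∷ Z) a           ≡⟨ cong (weight a X b +_) (weight-++ b Y c Z a) ⟩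
        weight a X b + (weight b Y c + weight c Z a)     ≡⟨ ℕₚ.+-assoc (weight a X b) _ _ ⟨
        weight a X b + weight b Y c + weight c Z a       ∎
        where open ≡-Reasoning

    quadrilateral : ∀ {a b c d} X Y Z W → Walk a X b → Walk b Y c → Walk c Z d → Walk d W a →
                    Distinct (a ∷ X ++ b ∷ Y ++ c ∷ Z ++ d ∷ W) →
                    Admissible (weight a X b + weight b Y c + weight c Z d + weight d W a)
    quadrilateral {a} {b} {c} {d} X Y Z W p q r s dist = subst Admissible weight≡
      (triangle X Y (Z ++ d ∷ W) p q (Walk-++ Z r s) dist)
      where
      weight≡ : weight a X b + weight b Y c + weight c (Z ++ d ∷ W) a
              ≡ weight a X b + weight b Y c + weight c Z d + weight d W a
      weight≡ = trans (cong (weight a X b + weight b Y c +_) (weight-++ c Z d W a))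
                      (sym (ℕₚ.+-assoc (weight a X b + weight b Y c) _ _))

    -- The lists are the interiors of the six subdivided edges and may be empty. In each of the
    -- seven cycles, a path met against its direction is reversed, and `weight-reverse` gives it
    -- back its weight.
    no-K₄-subdivision : ∀ {a b c d} P Q R S U V →
      Walk a P b → Walk a Q c → Walk a R d → Walk b S c → Walk b U d → Walk c V d →
      Distinct (a ∷ b ∷ c ∷ d ∷ P ++ Q ++ R ++ S ++ U ++ V) → ⊥
    no-K₄-subdivision {a} {b} {c} {d} P Q R S U V ab ac ad bc bd cd dist =
      k4-not-admissible (weight a P b) (weight a Q c) (weight a R d)
                        (weight b S c) (weight b U d) (weight c V d)
        (subst (λ k → Admissible (weight a P b + weight b S c + k)) (weight-reverse a Q c)
          (triangle P S (reverse Q) ab bc (Walk-reverse Q ac)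
            (sub (seg (# 0) ⊕ seg (# 4) ⊕ seg (# 1) ⊕ seg (# 7) ⊕ seg (# 2) ⊕ rev (seg (# 5))) dist)))
        (subst (λ k → Admissible (weight a P b + weight b U d + k)) (weight-reverse a R d)
          (triangle P U (reverse R) ab bd (Walk-reverse R ad)
            (sub (seg (# 0) ⊕ seg (# 4) ⊕ seg (# 1) ⊕ seg (# 8) ⊕ seg (# 3) ⊕ rev (seg (# 6))) dist)))
        (subst (λ k → Admissible (weight a Q c + weight c V d + k)) (weight-reverse a R d)
          (triangle Q V (reverse R) ac cd (Walk-reverse R ad)
            (sub (seg (# 0) ⊕ seg (# 5) ⊕ seg (# 2) ⊕ seg (# 9) ⊕ seg (# 3) ⊕ rev (seg (# 6))) dist)))
        (subst (λ k → Admissible (weight b S c + weight c V d + k)) (weight-reverse b U d)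
          (triangle S V (reverse U) bc cd (Walk-reverse U bd)
            (sub (seg (# 1) ⊕ seg (# 7) ⊕ seg (# 2) ⊕ seg (# 9) ⊕ seg (# 3) ⊕ rev (seg (# 8))) dist)))
        (subst (λ k → Admissible (weight a P b + weight b S c + weight c V d + k)) (weight-reverse a R d)
          (quadrilateral P S V (reverse R) ab bc cd (Walk-reverse R ad)
            (sub (seg (# 0) ⊕ seg (# 4) ⊕ seg (# 1) ⊕ seg (# 7) ⊕ seg (# 2) ⊕ seg (# 9)
                  ⊕ seg (# 3) ⊕ rev (seg (# 6))) dist)))
        (subst (λ k → Admissible (weight a P b + weight b U d + k + weight a Q c)) (weight-reverse c V d)
          (subst (λ k → Admissible (weight a P b + weight b U d + weight d (reverse V) c + k)) (weight-reverse a Q c)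
            (quadrilateral P U (reverse V) (reverse Q) ab bd (Walk-reverse V cd) (Walk-reverse Q ac)
              (sub (seg (# 0) ⊕ seg (# 4) ⊕ seg (# 1) ⊕ seg (# 8) ⊕ seg (# 3) ⊕ rev (seg (# 9))
                    ⊕ seg (# 2) ⊕ rev (seg (# 5))) dist))))
        (subst (λ k → Admissible (weight a Q c + k + weight b U d + weight a R d)) (weight-reverse b S c)
          (subst (λ k → Admissible (weight a Q c + weight c (reverse S) b + weight b U d + k)) (weight-reverse a R d)
            (quadrilateral Q (reverse S) U (reverse R) ac (Walk-reverse S bc) bd (Walk-reverse R ad)
              (sub (seg (# 0) ⊕ seg (# 5) ⊕ seg (# 2) ⊕ rev (seg (# 7)) ⊕ seg (# 1) ⊕ seg (# 8)
                    ⊕ seg (# 3) ⊕ rev (seg (# 6))) dist))))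
      where
      ρ : Vec (List (Fin n)) 10
      ρ = [ a ] ∷ [ b ] ∷ [ c ] ∷ [ d ] ∷ P ∷ Q ∷ R ∷ S ∷ U ∷ V ∷ []
      all : Expr 10
      all = seg (# 0) ⊕ seg (# 1) ⊕ seg (# 2) ⊕ seg (# 3) ⊕ seg (# 4)
          ⊕ seg (# 5) ⊕ seg (# 6) ⊕ seg (# 7) ⊕ seg (# 8) ⊕ seg (# 9)
      sub : ∀ e {_ : True (Finₚ.all? (λ i → uses e i ℕ.≤? uses all i))} → Distinct (⟦ ρ ⟧ all) → Distinct (⟦ ρ ⟧ e)
      sub e {le} = Distinct-sub ρ all e {le}

    -- Path rotations under minimum degree three

    Chain : Fin n → List (Fin n) → Set
    Chain u []       = ⊤
    Chain u (x ∷ xs) = Edge G u x × Chain x xs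

    Chain-++ : ∀ {u x} xs {ys} → Walk u xs x → Chain x ys → Chain u (xs ++ x ∷ ys)
    Chain-++ []       e       q = e , q
    Chain-++ (_ ∷ xs) (e , p) q = e , Chain-++ xs p q

    Chain-split : ∀ {u x} xs {ys} → Chain u (xs ++ x ∷ ys) → Walk u xs x × Chain x ys
    Chain-split []       (e , q) = e , q
    Chain-split (_ ∷ xs) (e , p) with p₁ , p₂ ← Chain-split xs p = (e , p₁) , p₂

    Chain-reverse-++ : ∀ {u x} xs {ys} → Walk u xs x → Chain u ys → Chain x (reverse xs ++ u ∷ ys)
    Chain-reverse-++ xs p q = Chain-++ (reverse xs) (Walk-reverse xs p) q

    -- The fuel k bounds how many more vertices can be added to the path.
    record Fits (k : ℕ) (xs : List (Fin n)) : Set where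
      constructor fits
      field
        dist : Distinct xs
        long : n < k + length xs
    open Fits

    grown : ∀ {k x xs} → ¬ x ∈ xs → Fits (suc k) xs → Fits k (x ∷ xs)
    grown {k} {x} {xs} x∉xs (fits d l) =
      fits (Distinct-∷ x∉xs d) (ℕₚ.≤-trans l (ℕₚ.≤-reflexive (sym (ℕₚ.+-suc k (length xs)))))

    rearranged : ∀ {k m} (ρ : Vec (List (Fin n)) m) e f
      {_ : True (Finₚ.all? (λ i → uses f i ℕ.≤? uses e i))}
      {_ : True (Finₚ.all? (λ i → uses e i ℕ.≤? uses f i))} →
      Fits k (⟦ ρ ⟧ e) → Fits k (⟦ ρ ⟧ f)
    rearranged {k} ρ e f {f≤e} {e≤f} (fits d l) =
      fits (Distinct-sub ρ e f {f≤e} d) (ℕₚ.≤-trans l (ℕₚ.+-monoʳ-≤ k (length-sub ρ e f {e≤f})))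

    -- On a path v Q w, `headOr w Q` is the successor of `v` and `lastOr v Q` the predecessor of
    -- `w`; the defaults are right when `Q` is empty.
    headOr lastOr : Fin n → List (Fin n) → Fin n
    headOr v []       = v
    headOr v (x ∷ _)  = x
    lastOr v []       = v
    lastOr v (x ∷ xs) = lastOr x xs

    lastOr-∷ʳ : ∀ v xs x → lastOr v (xs ∷ʳ x) ≡ x
    lastOr-∷ʳ v []       x = refl
    lastOr-∷ʳ v (y ∷ xs) x = lastOr-∷ʳ y xs x

    module _ (third : ∀ v a b → ∃ λ c → Edge G v c × c ≢ a × c ≢ b) where
      open DecMembership (Fin._≟_ {n}) using (_∈?_)

      -- v, w, t and j span a K₄ subdivision; when the third neighbour of w lies
      -- before j, it takes the place of j.
      chords-K₄ : ∀ {v w t j u} Q A B → Walk v Q w → Edge G w t → Edge G v t →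
        Chain t (A ++ j ∷ B) → Edge G v j → Edge G w u → u ∈ A ++ j ∷ B →
        Distinct (v ∷ (Q ∷ʳ w) ++ t ∷ A ++ j ∷ B) → ⊥
      chords-K₄ {v} {w} {t} {j} {u} Q A B v~w w~t v~t tZ v~j w~u u∈Z d with ∈-++⁻ A u∈Z
      ... | inj₂ (here refl) =
        no-K₄-subdivision Q [] [] [] [] A v~w v~t v~j w~t w~u (proj₁ (Chain-split A tZ))
          (Distinct-sub ([ v ] ∷ Q ∷ [ w ] ∷ [ t ] ∷ A ∷ [ j ] ∷ B ∷ [])
            (seg (# 0) ⊕ (seg (# 1) ⊕ seg (# 2)) ⊕ seg (# 3) ⊕ seg (# 4) ⊕ seg (# 5) ⊕ seg (# 6))
            (seg (# 0) ⊕ seg (# 2) ⊕ seg (# 3) ⊕ seg (# 5) ⊕ seg (# 1) ⊕ seg (# 4)) d)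
      ... | inj₂ (there u∈B) with C , D , refl ← ∈-∃++ u∈B =
        no-K₄-subdivision Q [] [] [] (u ∷ reverse C) A v~w v~t v~j w~t
          (w~u , Walk-reverse C (proj₁ (Chain-split C (proj₂ (Chain-split A tZ)))))
          (proj₁ (Chain-split A tZ))
          (Distinct-sub ([ v ] ∷ Q ∷ [ w ] ∷ [ t ] ∷ A ∷ [ j ] ∷ C ∷ [ u ] ∷ D ∷ [])
            (seg (# 0) ⊕ (seg (# 1) ⊕ seg (# 2)) ⊕ seg (# 3) ⊕ seg (# 4) ⊕ seg (# 5)
              ⊕ seg (# 6) ⊕ seg (# 7) ⊕ seg (# 8))
            (seg (# 0) ⊕ seg (# 2) ⊕ seg (# 3) ⊕ seg (# 5) ⊕ seg (# 1)
              ⊕ (seg (# 7) ⊕ rev (seg (# 6))) ⊕ seg (# 4)) d)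
      ... | inj₁ u∈A with C , D , refl ← ∈-∃++ u∈A =
        no-K₄-subdivision Q [] (j ∷ reverse D) [] [] C v~w v~t
          (v~j , Walk-reverse D (proj₂ tuj))
          w~t w~u (proj₁ tuj)
          (Distinct-sub ([ v ] ∷ Q ∷ [ w ] ∷ [ t ] ∷ C ∷ [ u ] ∷ D ∷ [ j ] ∷ B ∷ [])
            (seg (# 0) ⊕ (seg (# 1) ⊕ seg (# 2)) ⊕ seg (# 3) ⊕ (seg (# 4) ⊕ seg (# 5) ⊕ seg (# 6))
              ⊕ seg (# 7) ⊕ seg (# 8))
            (seg (# 0) ⊕ seg (# 2) ⊕ seg (# 3) ⊕ seg (# 5) ⊕ seg (# 1)
              ⊕ (seg (# 7) ⊕ rev (seg (# 6))) ⊕ seg (# 4)) d)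
        where tuj = Walk-split C (proj₁ (Chain-split (C ++ u ∷ D) tZ))

      prefix-length : ∀ {k} (A : List (Fin n)) {x B} → length (A ++ x ∷ B) ≤ suc k → length A ≤ k
      prefix-length A {x} {B} le = ℕₚ.≤-pred (ℕₚ.≤-trans (ℕₚ.≤-trans
        (ℕₚ.≤-trans (s≤s (ℕₚ.m≤m+n (length A) (length B)))
          (ℕₚ.≤-reflexive (sym (ℕₚ.+-suc (length A) (length B)))))
        (ℕₚ.≤-reflexive (sym (Listₚ.length-++ A)))) le)

      -- Rotation at the chord v t: the part before `t` is run through backwards, so that `w`
      -- replaces `v` as the start while the vertex set and the fuel stay the same.
      turned : ∀ k v Q w t Z → Fits (suc k) (v ∷ (Q ∷ʳ w) ++ t ∷ Z) → Fits (suc k) (w ∷ reverse Q ++ v ∷ t ∷ Z)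
      turned k v Q w t Z = rearranged ([ v ] ∷ Q ∷ [ w ] ∷ [ t ] ∷ Z ∷ [])
        (seg (# 0) ⊕ (seg (# 1) ⊕ seg (# 2)) ⊕ seg (# 3) ⊕ seg (# 4))
        (seg (# 2) ⊕ rev (seg (# 1)) ⊕ seg (# 0) ⊕ seg (# 3) ⊕ seg (# 4))

      mutual
        -- Instead of choosing a maximal path, the recursion descends lexicographically: a new
        -- vertex costs fuel, and with the fuel fixed the bound `m` on the segment cut off by the
        -- chord falls. Without fuel the path would have more than n vertices.
        grow : ∀ k v L → Chain v L → Fits k (v ∷ L) → ⊥
        grow zero v L _ (fits d l) = ℕₚ.<⇒≱ l (Distinct⇒length≤ d)
        grow (suc k) v [] _ F with third v v v
        ... | c , v~c , c≢v , _ = grow k c (v ∷ []) (Edge-sym v~c , tt) (grown c∉ F)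
          where
          c∉ : ¬ c ∈ v ∷ []
          c∉ (here c≡v) = c≢v c≡v
        grow (suc k) v (x ∷ L) vL F with third v x x
        ... | c , v~c , c≢x , _ with c ∈? (v ∷ x ∷ L)
        ... | no c∉ = grow k c (v ∷ x ∷ L) (Edge-sym v~c , vL) (grown c∉ F)
        ... | yes (here c≡v) = Edge-irrefl v~c (sym c≡v)
        ... | yes (there (here c≡x)) = c≢x c≡x
        -- As `c` is not the successor `x` of `v`, the chord v c cuts off a nonempty segment.
        ... | yes (there (there c∈L)) with X , Z , refl ← ∈-∃++ c∈L =
          shrink k (length (x ∷ X)) v (x ∷ X) c Z (s≤s z≤n) ℕₚ.≤-refl
            (proj₁ (Chain-split (x ∷ X) vL)) v~c (proj₂ (Chain-split (x ∷ X) vL)) F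

        -- The chord v t cuts off the segment X of the path v X t Z.
        shrink : ∀ k m v X t Z → 1 ≤ length X → length X ≤ m →
                 Walk v X t → Edge G v t → Chain t Z → Fits (suc k) (v ∷ X ++ t ∷ Z) → ⊥
        shrink k zero    v X t Z 1≤X X≤0 _ _ _ _ = ℕₚ.<⇒≱ 1≤X X≤0
        shrink k (suc m) v X t Z 1≤X X≤m p v~t q F with initLast X
        ... | Q ∷ʳ′ w = neighbour-of-start k m v Q w t Z X≤m (Walk-split Q p) v~t q F

        -- A third neighbour `j` of `v` inside the segment gives a chord cutting off less, and one
        -- outside the path extends it. What remains is `j` beyond `t`, and then the other end `w`
        -- of the segment is examined.
        neighbour-of-start : ∀ k m v Q w t Z → length (Q ∷ʳ w) ≤ suc m → Walk v Q w × Edge G w t →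
          Edge G v t → Chain t Z → Fits (suc k) (v ∷ (Q ∷ʳ w) ++ t ∷ Z) → ⊥
        neighbour-of-start k m v Q w t Z X≤m (p , w~t) v~t q F with third v t (headOr w Q)
        ... | j , v~j , j≢t , j≢head with j ∈? (Q ∷ʳ w)
        ... | yes j∈X with ∈-∃++ j∈X
        -- With nothing before it, `j` would be the successor of `v` on the path.
        ...   | [] , B , eq = j≢head (sym (headOr≡ Q eq))
          where
          headOr≡ : ∀ Q → Q ∷ʳ w ≡ j ∷ B → headOr w Q ≡ j
          headOr≡ []      refl = refl
          headOr≡ (_ ∷ _) refl = refl
        ...   | A@(_ ∷ _) , B , eq =
          shrink k m v A j (B ++ t ∷ Z) (s≤s z≤n)
            (prefix-length A (subst (λ L → length L ≤ suc m) eq X≤m))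
            (proj₁ vjt) v~j (Chain-++ B (proj₂ vjt) q)
            (rearranged ([ v ] ∷ A ∷ [ j ] ∷ B ∷ [ t ] ∷ Z ∷ [])
              (seg (# 0) ⊕ (seg (# 1) ⊕ seg (# 2) ⊕ seg (# 3)) ⊕ seg (# 4) ⊕ seg (# 5))
              (seg (# 0) ⊕ seg (# 1) ⊕ seg (# 2) ⊕ seg (# 3) ⊕ seg (# 4) ⊕ seg (# 5))
              (subst (λ L → Fits (suc k) (v ∷ L ++ t ∷ Z)) eq F))
          where vjt = Walk-split A (subst (λ L → Walk v L t) eq (Walk-++ Q p w~t))
        neighbour-of-start k m v Q w t Z X≤m (p , w~t) v~t q F
            | j , v~j , j≢t , j≢head | no j∉X with j ∈? Z
        ... | yes j∈Z = neighbour-of-turn k m v Q w t Z X≤m p w~t v~t q v~j j∈Z F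
        ... | no j∉Z = grow k j (v ∷ (Q ∷ʳ w) ++ t ∷ Z)
                         (Edge-sym v~j , Chain-++ (Q ∷ʳ w) (Walk-++ Q p w~t) q) (grown j∉ F)
          where
          j∉ : ¬ j ∈ v ∷ (Q ∷ʳ w) ++ t ∷ Z
          j∉ (here j≡v) = Edge-irrefl v~j (sym j≡v)
          j∉ (there j∈) with ∈-++⁻ (Q ∷ʳ w) j∈
          ... | inj₁ j∈X = j∉X j∈X
          ... | inj₂ (here j≡t) = j≢t j≡t
          ... | inj₂ (there j∈Z) = j∉Z j∈Z

        -- The vertex `w` starts the rotated path, so it can be treated like `v`. A third neighbour
        -- `u` in `Q`, or equal to `v`, gives a chord of the rotated path that cuts off at most `m`
        -- vertices; one outside extends the rotated path. If `u` lies beyond `t`, then both `v` and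
        -- `w` have chords into `Z`, and these make the K₄ subdivision.
        neighbour-of-turn : ∀ k m v Q w t Z {j} → length (Q ∷ʳ w) ≤ suc m → Walk v Q w → Edge G w t →
          Edge G v t → Chain t Z → Edge G v j → j ∈ Z → Fits (suc k) (v ∷ (Q ∷ʳ w) ++ t ∷ Z) → ⊥
        neighbour-of-turn k m v Q w t Z X≤m p w~t v~t q v~j j∈Z F with third w t (lastOr v Q)
        ... | u , w~u , u≢t , u≢last with u ∈? Z
        ... | yes u∈Z with A , B , refl ← ∈-∃++ j∈Z = chords-K₄ Q A B p w~t v~t q v~j w~u u∈Z (dist F)
        ... | no u∉Z with u ∈? Q
        ... | yes u∈Q with ∈-∃++ u∈Q
        ...   | A , [] , refl = u≢last (sym (lastOr-∷ʳ v A u))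
        ...   | A , B@(_ ∷ _) , refl =
          -- On the rotated path w, `reverse B`, u, `reverse A`, v, t, Z the chord w u cuts off only
          -- `B`.
          shrink k m w (reverse B) u (reverse A ++ v ∷ t ∷ Z)
            (ℕₚ.≤-trans (s≤s z≤n) (ℕₚ.≤-reflexive (sym (Listₚ.length-reverse B))))
            (ℕₚ.≤-trans (length-sub (B ∷ A ∷ [ u ] ∷ []) (rev (seg (# 0))) (seg (# 1) ⊕ seg (# 2) ⊕ seg (# 0)))
              (prefix-length (A ++ u ∷ B) X≤m))
            (Walk-reverse B (proj₂ (Walk-split A p))) w~u
            (Chain-reverse-++ A (proj₁ (Walk-split A p)) (v~t , q))
            (rearranged ([ v ] ∷ A ∷ [ u ] ∷ B ∷ [ w ] ∷ [ t ] ∷ Z ∷ [])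
              (seg (# 0) ⊕ ((seg (# 1) ⊕ seg (# 2) ⊕ seg (# 3)) ⊕ seg (# 4)) ⊕ seg (# 5) ⊕ seg (# 6))
              (seg (# 4) ⊕ rev (seg (# 3)) ⊕ seg (# 2) ⊕ rev (seg (# 1)) ⊕ seg (# 0) ⊕ seg (# 5) ⊕ seg (# 6))
              F)
        neighbour-of-turn k m v Q w t Z X≤m p w~t v~t q v~j j∈Z F
            | u , w~u , u≢t , u≢last | no u∉Z | no u∉Q with u Fin.≟ v
        neighbour-of-turn k m v []        w t Z X≤m p w~t v~t q v~j j∈Z F
            | u , w~u , u≢t , u≢last | no u∉Z | no u∉Q | yes refl = u≢last refl
        neighbour-of-turn k m v Q@(_ ∷ _) w t Z X≤m p w~t v~t q v~j j∈Z F
            | u , w~u , u≢t , u≢last | no u∉Z | no u∉Q | yes refl =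
          shrink k m w (reverse Q) v (t ∷ Z)
            (ℕₚ.≤-trans (s≤s z≤n) (ℕₚ.≤-reflexive (sym (Listₚ.length-reverse Q))))
            (ℕₚ.≤-trans (ℕₚ.≤-reflexive (Listₚ.length-reverse Q)) (prefix-length Q X≤m))
            (Walk-reverse Q p) w~u (v~t , q) (turned k v Q w t Z F)
        neighbour-of-turn k m v Q w t Z X≤m p w~t v~t q v~j j∈Z F
            | u , w~u , u≢t , u≢last | no u∉Z | no u∉Q | no u≢v =
          grow k u (w ∷ reverse Q ++ v ∷ t ∷ Z)
            (Edge-sym w~u , Chain-reverse-++ Q p (v~t , q)) (grown u∉ (turned k v Q w t Z F))
          where
          u∉ : ¬ u ∈ w ∷ reverse Q ++ v ∷ t ∷ Z
          u∉ (here u≡w) = Edge-irrefl w~u (sym u≡w)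
          u∉ (there u∈) with ∈-++⁻ (reverse Q) u∈
          ... | inj₁ u∈Qʳ = u∉Q (reverse⁻ u∈Qʳ)
          ... | inj₂ (here u≡v) = u≢v u≡v
          ... | inj₂ (there (here u≡t)) = u≢t u≡t
          ... | inj₂ (there (there u∈Z)) = u∉Z u∈Z

      min-degree-3-impossible : Fin n → ⊥
      -- The path already has one vertex, so fuel n suffices to exceed n.
      min-degree-3-impossible v = grow n v [] tt
        (fits (Distinct-∷ (λ ()) (distinct λ _ → z≤n)) (ℕₚ.≤-reflexive (ℕₚ.+-comm 1 n)))

-- Elimination of a vertex with at most two neighbours

module Elimination {n : ℕ} (G : Graph (suc n)) (wt : Fin (suc n) → Fin (suc n) → ℕ)
                   (wt-sym : ∀ u w → wt u w ≡ wt w u) (v : Fin (suc n)) where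
  open Graph G using (adj)
  open Weighted G wt wt-sym

  private
    p : Fin n → Fin (suc n)
    p = punchIn v

  joined : Fin n → Fin n → Bool
  joined a b = not (does (a Fin.≟ b)) ∧ adj v (p a) ∧ adj v (p b)

  joined-sym : ∀ a b → joined a b ≡ joined b a
  joined-sym a b with a Fin.≟ b | b Fin.≟ a
  ... | yes _   | yes _   = refl
  ... | yes a≡b | no b≢a  = contradiction (sym a≡b) b≢a
  ... | no a≢b  | yes b≡a = contradiction (sym b≡a) a≢b
  ... | no _    | no _    = Boolₚ.∧-comm (adj v (p a)) (adj v (p b))

  eliminate : Graph n
  eliminate .Graph.adj a b = adj (p a) (p b) ∨ joined a b
  eliminate .Graph.sym a b = cong₂ _∨_ (Graph.sym G (p a) (p b)) (joined-sym a b)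
  eliminate .Graph.irrefl a with a Fin.≟ a
  ... | yes _  = trans (Boolₚ.∨-identityʳ _) (Graph.irrefl G (p a))
  ... | no a≢a = contradiction refl a≢a

  -- An edge that is already present keeps its weight: cycles only have to be lifted from the
  -- smaller graph, so the parallel detour may be forgotten.
  wt′ : Fin n → Fin n → ℕ
  wt′ a b = if adj (p a) (p b) then wt (p a) (p b) else wt (p a) v + wt v (p b)

  wt′-sym : ∀ a b → wt′ a b ≡ wt′ b a
  wt′-sym a b rewrite Graph.sym G (p a) (p b) with adj (p b) (p a)
  ... | true  = wt-sym (p a) (p b)
  ... | false = trans (ℕₚ.+-comm (wt (p a) v) _) (cong₂ _+_ (wt-sym v (p b)) (wt-sym (p a) v))

  module W′ = Weighted eliminate wt′ wt′-sym

  data EdgeView (a b : Fin n) : Set where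
    old  : Edge G (p a) (p b) → wt′ a b ≡ wt (p a) (p b) → EdgeView a b
    fill : a ≢ b → Edge G v (p a) → Edge G v (p b) →
           wt′ a b ≡ wt (p a) v + wt v (p b) → EdgeView a b

  edge-view : ∀ {a b} → Edge eliminate a b → EdgeView a b
  edge-view {a} {b} e with adj (p a) (p b) in eq
  ... | true  = old eq (cong (if_then wt (p a) (p b) else (wt (p a) v + wt v (p b))) eq)
  ... | false with a Fin.≟ b | adj v (p a) in va | adj v (p b) in vb
  ...   | no a≢b | true | true =
    fill a≢b va vb (cong (if_then wt (p a) (p b) else (wt (p a) v + wt v (p b))) eq)

  edge-kept : ∀ {a b} → Edge G (p a) (p b) → Edge eliminate a b
  edge-kept {a} {b} e = cong (_∨ joined a b) e

  neighbours-joined : ∀ {a b} → a ≢ b → Edge G v (p a) → Edge G v (p b) → Edge eliminate a b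
  neighbours-joined {a} {b} a≢b va vb with a Fin.≟ b
  ... | yes a≡b = contradiction a≡b a≢b
  ... | no _    = trans (cong (adj (p a) (p b) ∨_) (cong₂ _∧_ va vb)) (Boolₚ.∨-zeroʳ _)

  δ-punchIn : ∀ z x → δ (p z) (p x) ≡ δ z x
  δ-punchIn z x with z Fin.≟ x
  ... | yes refl = δ-refl (p z)
  ... | no z≢x   = δ-≢ (z≢x ∘ Finₚ.punchIn-injective v z x)

  δ-v-punchIn : ∀ x → δ v (p x) ≡ 0
  δ-v-punchIn x = δ-≢ (Finₚ.punchInᵢ≢i v x ∘ sym)

  δ-punchIn-v : ∀ z → δ (p z) v ≡ 0
  δ-punchIn-v z = δ-≢ (Finₚ.punchInᵢ≢i v z)

  -- Every fill edge is replaced by a detour through `v`, and `k` bounds the visits to `v`. The lift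
  -- of a cycle is again a cycle because `k` is 1 there, and `length≤` keeps it from being too
  -- short.
  record Lift (k : ℕ) (a : Fin n) (L : List (Fin n)) (b : Fin n) : Set where
    field
      interior : List (Fin (suc n))
      walk     : Walk (p a) interior (p b)
      weight≡  : weight (p a) interior (p b) ≡ W′.weight a L b
      length≤  : length L ≤ length interior
      count-p  : ∀ z → count (p z) interior ≡ count z L
      count-v  : count v interior ≤ k
  open Lift

  lift-edge : ∀ {a b} → Edge G (p a) (p b) → wt′ a b ≡ wt (p a) (p b) → Lift 0 a [] b
  lift-edge e w = record { interior = [] ; walk = e ; weight≡ = sym w ; length≤ = z≤n
                         ; count-p = λ _ → refl ; count-v = z≤n }

  lift-old : ∀ {k a c L b} → Edge G (p a) (p c) → wt′ a c ≡ wt (p a) (p c) → Lift k c L b → Lift k a (c ∷ L) b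
  lift-old {c = c} e w ℓ = record
    { interior = p c ∷ interior ℓ
    ; walk     = e , walk ℓ
    ; weight≡  = cong₂ _+_ (sym w) (weight≡ ℓ)
    ; length≤  = s≤s (length≤ ℓ)
    ; count-p  = λ z → cong₂ _+_ (δ-punchIn z c) (count-p ℓ z)
    ; count-v  = subst (λ d → d + count v (interior ℓ) ≤ _) (sym (δ-v-punchIn c)) (count-v ℓ)
    }

  lift-fill-edge : ∀ {a b} → Edge G v (p a) → Edge G v (p b) → wt′ a b ≡ wt (p a) v + wt v (p b) → Lift 1 a [] b
  lift-fill-edge va vb w = record
    { interior = v ∷ [] ; walk = Edge-sym va , vb ; weight≡ = sym w ; length≤ = z≤n
    ; count-p = λ z → cong (_+ 0) (δ-punchIn-v z)
    ; count-v = ℕₚ.≤-reflexive (cong (_+ 0) (δ-refl v)) }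

  lift-fill : ∀ {a c L b} → Edge G v (p a) → Edge G v (p c) → wt′ a c ≡ wt (p a) v + wt v (p c) →
              Lift 0 c L b → Lift 1 a (c ∷ L) b
  lift-fill {a} {c} {L} {b} va vc w ℓ = record
    { interior = v ∷ p c ∷ interior ℓ
    ; walk     = Edge-sym va , vc , walk ℓ
    ; weight≡  = trans (sym (ℕₚ.+-assoc (wt (p a) v) _ _)) (cong₂ _+_ (sym w) (weight≡ ℓ))
    ; length≤  = ℕₚ.≤-trans (s≤s (length≤ ℓ)) (ℕₚ.n≤1+n _)
    ; count-p  = λ z → cong₂ _+_ (δ-punchIn-v z) (cong₂ _+_ (δ-punchIn z c) (count-p ℓ z))
    ; count-v  = subst (_≤ 1) (sym (cong₂ _+_ (δ-refl v) (cong (_+ count v (interior ℓ)) (δ-v-punchIn c))))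
                   (s≤s (count-v ℓ))
    }

  weaken : ∀ {a L b} → Lift 0 a L b → Lift 1 a L b
  weaken ℓ = record { interior = interior ℓ ; walk = walk ℓ ; weight≡ = weight≡ ℓ ; length≤ = length≤ ℓ
                    ; count-p = count-p ℓ ; count-v = ℕₚ.≤-trans (count-v ℓ) z≤n }

  -- Both ends of a fill edge are neighbours of `v`. With no such vertex in the interior, a fill
  -- edge could only be the whole walk, which the last hypothesis rules out.
  lift-plain : ∀ {a} L {b} → W′.Walk a L b → (∀ {z} → z ∈ L → ¬ Edge G v (p z)) →
               (Edge G v (p a) → Edge G v (p b) → L ≢ []) → Lift 0 a L b
  lift-plain [] e _ ends with edge-view e
  ... | old e′ w       = lift-edge e′ w
  ... | fill _ va vb _ = contradiction refl (ends va vb)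
  lift-plain (c ∷ L) (e , q) avoid _ with edge-view e
  ... | old e′ w       = lift-old e′ w (lift-plain L q (avoid ∘ there) (λ vc _ → contradiction vc (avoid (here refl))))
  ... | fill _ _ vc _  = contradiction vc (avoid (here refl))

  module _ (two : ∀ {a b c} → a ≢ b → Edge G v a → Edge G v b → Edge G v c → c ≡ a ⊎ c ≡ b) where

    only-two : ∀ {a b c} → a ≢ b → c ≢ a → c ≢ b → Edge G v (p a) → Edge G v (p b) → ¬ Edge G v (p c)
    only-two {a} {b} {c} a≢b c≢a c≢b va vb vc with two (a≢b ∘ Finₚ.punchIn-injective v a b) va vb vc
    ... | inj₁ eq = c≢a (Finₚ.punchIn-injective v c a eq)
    ... | inj₂ eq = c≢b (Finₚ.punchIn-injective v c b eq)

    -- The ends of the first fill edge are the only two neighbours of `v`, and distinctness keeps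
    -- the rest of the path off the pair, so no second detour occurs.
    lift-path : ∀ {a} L {b} → W′.Walk a L b → Distinct (a ∷ L ∷ʳ b) → Lift 1 a L b
    lift-path [] e d with edge-view e
    ... | old e′ w       = weaken (lift-edge e′ w)
    ... | fill _ va vb w = lift-fill-edge va vb w
    lift-path {a} (c ∷ L) {b} (e , q) d with edge-view e
    ... | old e′ w         = lift-old e′ w (lift-path L q (Distinct-tail d))
    ... | fill a≢c va vc w = lift-fill va vc w (lift-plain L q (λ z∈L → outside (∈-++⁺ˡ z∈L))
                               (λ _ vb → contradiction vb (outside (∈-++⁺ʳ L (here refl)))))
      where
      outside : ∀ {z} → z ∈ L ∷ʳ b → ¬ Edge G v (p z)
      outside z∈ = only-two a≢c (Distinct-head d (there z∈) ∘ sym)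
                                (Distinct-head (Distinct-tail d) z∈ ∘ sym) va vc

    lift-cycle : ∀ {u} L → 2 ≤ length L → W′.Walk u L u → Distinct (u ∷ L) → Lift 1 u L u
    lift-cycle (_ ∷ []) (s≤s ())
    lift-cycle {u} (x ∷ L@(_ ∷ _)) _ (e , q) d with edge-view e
    ... | old e′ w = lift-old e′ w (lift-path L q
      (Distinct-sub ([ u ] ∷ [ x ] ∷ L ∷ []) (seg (# 0) ⊕ seg (# 1) ⊕ seg (# 2))
        (seg (# 1) ⊕ seg (# 2) ⊕ seg (# 0)) d))
    ... | fill u≢x vu vx w = lift-fill vu vx w (lift-plain L q
      (λ z∈L → only-two u≢x (Distinct-head d (there z∈L) ∘ sym)
                            (Distinct-head (Distinct-tail d) z∈L ∘ sym) vu vx)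
      -- The remaining walk joins the two neighbours of `v` again; it does not repeat the fill edge
      -- because it has an interior vertex.
      (λ _ _ ()))

    eliminate-admissible : CyclesAdmissible → W′.CyclesAdmissible
    eliminate-admissible adm u L 2≤L q d =
      subst Admissible (weight≡ ℓ)
        (adm (p u) (interior ℓ) (ℕₚ.≤-trans 2≤L (length≤ ℓ)) (walk ℓ) (distinct bound))
      where
      ℓ : Lift 1 u L u
      ℓ = lift-cycle L 2≤L q d
      bound : ∀ z → count z (p u ∷ interior ℓ) ≤ 1
      bound z with v Fin.≟ z
      ... | yes refl = subst (λ k → k + count v (interior ℓ) ≤ 1) (sym (δ-v-punchIn u)) (count-v ℓ)
      ... | no v≢z   = subst (λ y → count y (p u ∷ interior ℓ) ≤ 1) (Finₚ.punchIn-punchOut v≢z)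
        (ℕₚ.≤-trans (ℕₚ.≤-reflexive (cong₂ _+_ (δ-punchIn (punchOut v≢z) u) (count-p ℓ (punchOut v≢z))))
                    (Distinct.count≤1 d (punchOut v≢z)))

-- Insertion of a vertex into a book embedding

data PunchView {n : ℕ} (v : Fin (suc n)) : Fin (suc n) → Set where
  hole : PunchView v v
  kept : ∀ a → PunchView v (punchIn v a)

punch-view : ∀ {n} (v u : Fin (suc n)) → PunchView v u
punch-view v u with v Fin.≟ u
... | yes refl = hole
... | no v≢u   = subst (PunchView v) (Finₚ.punchIn-punchOut v≢u) (kept (punchOut v≢u))

module Insertion {n : ℕ} {H : Graph n} (L : Layout H) (G : Graph (suc n)) (v : Fin (suc n))
                 (kept-edge : ∀ {a b} → Edge G (punchIn v a) (punchIn v b) → Edge H a b) where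
  open Layout L

  private
    p : Fin n → Fin (suc n)
    p = punchIn v

    flip : ∀ {a b} → Edge G a b → Edge G b a
    flip {a} {b} e = trans (Graph.sym G b a) e

    loop : ∀ {a} → Edge G a a → ⊥
    loop {a} e with () ← trans (sym e) (Graph.irrefl G a)

  -- v is placed just before the old vertices of rank at least s.
  module At (s : ℕ)
    -- The first four hypotheses treat the four places that `v` can take in a crossing pattern a < c
    -- < b < d; the page is `false` where the edge at `v` leads right and `true` where it comes from
    -- the left.
    (vb×cd : ∀ {b c d} → Edge G v (p b) → Edge H c d → page c d ≡ false →
             s ≤ rank c → rank c < rank b → rank b < rank d → ⊥)
    (av×cd : ∀ {a c d} → Edge G v (p a) → Edge H c d → page c d ≡ true →
             rank a < rank c → rank c < s → s ≤ rank d → ⊥)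
    (ab×vd : ∀ {a b d} → Edge G v (p d) → Edge H a b → page a b ≡ false →
             rank a < s → s ≤ rank b → rank b < rank d → ⊥)
    (ab×cv : ∀ {a b c} → Edge G v (p c) → Edge H a b → page a b ≡ true →
             rank a < rank c → rank c < rank b → rank b < s → ⊥)
    (left  : ∀ {a b} → Edge G v (p a) → Edge G v (p b) → rank a < s → rank b < s → a ≡ b)
    (right : ∀ {a b} → Edge G v (p a) → Edge G v (p b) → s ≤ rank a → s ≤ rank b → a ≡ b)
    where

    -- Old vertices receive odd ranks and `v` an even one, which leaves a gap at every `s` and
    -- settles injectivity by parity.
    rank′ : Fin (suc n) → ℕ
    rank′ = insertAt (λ a → suc (2 * rank a)) v (2 * s)

    -- Edges from `v` to the right go below and edges from the left to `v` go above. Thus no old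
    -- vertex gains a left upper or a right lower neighbour.
    page′ : Fin (suc n) → Fin (suc n) → Bool
    page′ = insertAt (λ a → insertAt (page a) v true) v (λ _ → false)

    rank-v : rank′ v ≡ 2 * s
    rank-v = insertAt-lookup _ v _

    rank-p : ∀ a → rank′ (p a) ≡ suc (2 * rank a)
    rank-p = insertAt-punchIn _ v _

    page-vp : ∀ b → page′ v b ≡ false
    page-vp b = cong (λ f → f b) (insertAt-lookup (λ a → insertAt (page a) v true) v (λ _ → false))

    page-pv : ∀ a → page′ (p a) v ≡ true
    page-pv a = trans (cong (λ f → f v) (insertAt-punchIn (λ a → insertAt (page a) v true) v (λ _ → false) a))
                      (insertAt-lookup (page a) v true)

    page-pp : ∀ a b → page′ (p a) (p b) ≡ page a b
    page-pp a b = trans (cong (λ f → f (p b)) (insertAt-punchIn (λ a → insertAt (page a) v true) v (λ _ → false) a))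
                        (insertAt-punchIn (page a) v true b)

    pp< : ∀ {a b} → rank′ (p a) < rank′ (p b) → rank a < rank b
    pp< {a} {b} lt rewrite rank-p a | rank-p b = ℕₚ.*-cancelˡ-< 2 _ _ (ℕₚ.≤-pred lt)

    pv< : ∀ {a} → rank′ (p a) < rank′ v → rank a < s
    pv< {a} lt rewrite rank-p a | rank-v = ℕₚ.*-cancelˡ-< 2 _ _ (ℕₚ.<-trans (ℕₚ.n<1+n _) lt)

    vp< : ∀ {a} → rank′ v < rank′ (p a) → s ≤ rank a
    vp< {a} lt rewrite rank-p a | rank-v = ℕₚ.*-cancelˡ-≤ 2 (ℕₚ.≤-pred lt)

    rank′-injective : ∀ a b → rank′ a ≡ rank′ b → a ≡ b
    rank′-injective a b eq with punch-view v a | punch-view v b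
    ... | hole    | hole    = refl
    ... | hole    | kept b′ = contradiction (trans (sym rank-v) (trans eq (rank-p b′))) (ℕₚ.even≢odd s (rank b′))
    ... | kept a′ | hole    = contradiction (trans (sym rank-v) (trans (sym eq) (rank-p a′))) (ℕₚ.even≢odd s (rank a′))
    ... | kept a′ | kept b′ = cong p (rank-injective a′ b′ (ℕₚ.*-cancelˡ-≡ _ _ 2
            (ℕₚ.suc-injective (trans (sym (rank-p a′)) (trans eq (rank-p b′))))))

    noncrossing′ : ∀ {a b c d} → Edge G a b → Edge G c d → page′ a b ≡ page′ c d →
                   rank′ a < rank′ c → rank′ c < rank′ b → rank′ b < rank′ d → ⊥
    noncrossing′ {a} {b} {c} {d} e f eq a<c c<b b<d
      with punch-view v a | punch-view v b | punch-view v c | punch-view v d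
    ... | kept a | kept b | kept c | kept d =
      noncrossing (kept-edge e) (kept-edge f) (trans (sym (page-pp a b)) (trans eq (page-pp c d)))
        (pp< a<c) (pp< c<b) (pp< b<d)
    ... | hole | kept b | kept c | kept d =
      vb×cd e (kept-edge f) (trans (sym (page-pp c d)) (trans (sym eq) (page-vp (p b))))
        (vp< a<c) (pp< c<b) (pp< b<d)
    ... | kept a | hole | kept c | kept d =
      av×cd (flip e) (kept-edge f) (trans (sym (page-pp c d)) (trans (sym eq) (page-pv a)))
        (pp< a<c) (pv< c<b) (vp< b<d)
    ... | kept a | kept b | hole | kept d =
      ab×vd f (kept-edge e) (trans (sym (page-pp a b)) (trans eq (page-vp (p d))))
        (pv< a<c) (vp< c<b) (pp< b<d)
    ... | kept a | kept b | kept c | hole =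
      ab×cv (flip f) (kept-edge e) (trans (sym (page-pp a b)) (trans eq (page-pv c)))
        (pp< a<c) (pp< c<b) (pv< b<d)
    ... | hole   | hole   | _      | _    = loop e
    ... | _      | _      | hole   | hole = loop f
    ... | hole   | kept _ | hole   | _    = ℕₚ.<-irrefl refl a<c
    ... | kept _ | hole   | hole   | _    = ℕₚ.<-irrefl refl c<b
    ... | kept _ | hole   | kept _ | hole = ℕₚ.<-irrefl refl b<d
    ... | hole   | kept _ | kept _ | hole = ℕₚ.<-asym (ℕₚ.<-trans a<c c<b) b<d

    left-unique′ : ∀ {a b c} → Edge G a c → Edge G b c → page′ a c ≡ true → page′ b c ≡ true →
                   rank′ a < rank′ c → rank′ b < rank′ c → a ≡ b
    left-unique′ {a} {b} {c} e f ea eb a<c b<c with punch-view v a | punch-view v b | punch-view v c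
    ... | kept a | kept b | kept c = cong p (left-unique (kept-edge e) (kept-edge f)
            (trans (sym (page-pp a c)) ea) (trans (sym (page-pp b c)) eb) (pp< a<c) (pp< b<c))
    ... | kept a | kept b | hole   = cong p (left (flip e) (flip f) (pv< a<c) (pv< b<c))
    ... | hole   | _      | _      = contradiction (trans (sym (page-vp c)) ea) λ ()
    ... | kept _ | hole   | _      = contradiction (trans (sym (page-vp c)) eb) λ ()

    right-unique′ : ∀ {a b c} → Edge G a b → Edge G a c → page′ a b ≡ false → page′ a c ≡ false →
                    rank′ a < rank′ b → rank′ a < rank′ c → b ≡ c
    right-unique′ {a} {b} {c} e f eb ec a<b a<c with punch-view v a | punch-view v b | punch-view v c
    ... | kept a | kept b | kept c = cong p (right-unique (kept-edge e) (kept-edge f)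
            (trans (sym (page-pp a b)) eb) (trans (sym (page-pp a c)) ec) (pp< a<b) (pp< a<c))
    ... | hole   | kept b | kept c = cong p (right e f (vp< a<b) (vp< a<c))
    ... | hole   | hole   | _      = ⊥-elim (loop e)
    ... | hole   | kept _ | hole   = ⊥-elim (loop f)
    ... | kept a | hole   | _      = contradiction (trans (sym (page-pv a)) eb) λ ()
    ... | kept a | kept _ | hole   = contradiction (trans (sym (page-pv a)) ec) λ ()

    layout : Layout G
    layout = record
      { rank = rank′ ; rank-injective = rank′-injective ; page = page′
      ; noncrossing = noncrossing′ ; left-unique = left-unique′ ; right-unique = right-unique′ }

  insert-isolated : (∀ a → ¬ Edge G v (p a)) → Layout G
  insert-isolated none = At.layout 0
    (λ e → contradiction e (none _)) (λ e → contradiction e (none _))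
    (λ e → contradiction e (none _)) (λ e → contradiction e (none _))
    (λ e → contradiction e (none _)) (λ e → contradiction e (none _))

  -- The edge v c runs alongside the lower edge x c. A lower edge crossing v c but not x c would
  -- have to start at `x`, which `right-unique` forbids; the edge x v joins consecutive vertices and
  -- crosses nothing.
  insert-after : ∀ x → (∀ {c} → Edge G v (p c) →
                   c ≡ x ⊎ (Edge H x c × rank x < rank c × page x c ≡ false)) → Layout G
  insert-after x nbr = At.layout (suc (rank x)) vb×cd av×cd ab×vd ab×cv left right
    where
    x≤ : ∀ {c} → Edge G v (p c) → rank x ≤ rank c
    x≤ e with nbr e
    ... | inj₁ refl          = ℕₚ.≤-refl
    ... | inj₂ (_ , x<c , _) = ℕₚ.<⇒≤ x<c
    is-x : ∀ {c} → Edge G v (p c) → rank c < suc (rank x) → c ≡ x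
    is-x e c≤x with nbr e
    ... | inj₁ c≡x           = c≡x
    ... | inj₂ (_ , x<c , _) = contradiction x<c (ℕₚ.≤⇒≯ (ℕₚ.≤-pred c≤x))
    lower : ∀ {c} → Edge G v (p c) → rank x < rank c → Edge H x c × page x c ≡ false
    lower e x<c with nbr e
    ... | inj₁ refl           = contradiction x<c (ℕₚ.<-irrefl refl)
    ... | inj₂ (xc , _ , low) = xc , low
    vb×cd : ∀ {b c d} → Edge G v (p b) → Edge H c d → page c d ≡ false →
            rank x < rank c → rank c < rank b → rank b < rank d → ⊥
    vb×cd vb cd low x<c c<b b<d with xb , low′ ← lower vb (ℕₚ.<-trans x<c c<b) =
      noncrossing xb cd (trans low′ (sym low)) x<c c<b b<d
    av×cd : ∀ {a c d} → Edge G v (p a) → Edge H c d → page c d ≡ true →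
            rank a < rank c → rank c < suc (rank x) → rank x < rank d → ⊥
    av×cd va _ _ a<c c≤x _ = ℕₚ.<⇒≱ a<c (ℕₚ.≤-trans (ℕₚ.≤-pred c≤x) (x≤ va))
    ab×vd : ∀ {a b d} → Edge G v (p d) → Edge H a b → page a b ≡ false →
            rank a < suc (rank x) → rank x < rank b → rank b < rank d → ⊥
    ab×vd {a} {b} {d} vd ab low a≤x x<b b<d
      with xd , low′ ← lower vd (ℕₚ.<-trans x<b b<d) | ℕₚ.m≤n⇒m<n∨m≡n (ℕₚ.≤-pred a≤x)
    ... | inj₁ a<x = noncrossing ab xd (trans low (sym low′)) a<x x<b b<d
    ... | inj₂ a≡x with refl ← rank-injective a x a≡x =
      ℕₚ.<-irrefl (cong rank (right-unique ab xd low low′ x<b (ℕₚ.<-trans x<b b<d))) b<d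
    ab×cv : ∀ {a b c} → Edge G v (p c) → Edge H a b → page a b ≡ true →
            rank a < rank c → rank c < rank b → rank b < suc (rank x) → ⊥
    ab×cv vc _ _ _ c<b b≤x = ℕₚ.<⇒≱ c<b (ℕₚ.≤-trans (ℕₚ.≤-pred b≤x) (x≤ vc))
    left : ∀ {a b} → Edge G v (p a) → Edge G v (p b) → rank a < suc (rank x) → rank b < suc (rank x) → a ≡ b
    left va vb a≤x b≤x = trans (is-x va a≤x) (sym (is-x vb b≤x))
    right : ∀ {a b} → Edge G v (p a) → Edge G v (p b) → rank x < rank a → rank x < rank b → a ≡ b
    right va vb x<a x<b with xa , la ← lower va x<a | xb , lb ← lower vb x<b =
      right-unique xa xb la lb x<a x<b

  -- The mirror image of `insert-after`, with the pages exchanged and `left-unique` in place of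
  -- `right-unique`.
  insert-before : ∀ y → (∀ {c} → Edge G v (p c) →
                    c ≡ y ⊎ (Edge H c y × rank c < rank y × page c y ≡ true)) → Layout G
  insert-before y nbr = At.layout (rank y) vb×cd av×cd ab×vd ab×cv left right
    where
    ≤y : ∀ {c} → Edge G v (p c) → rank c ≤ rank y
    ≤y e with nbr e
    ... | inj₁ refl          = ℕₚ.≤-refl
    ... | inj₂ (_ , c<y , _) = ℕₚ.<⇒≤ c<y
    is-y : ∀ {c} → Edge G v (p c) → rank y ≤ rank c → c ≡ y
    is-y e y≤c with nbr e
    ... | inj₁ c≡y           = c≡y
    ... | inj₂ (_ , c<y , _) = contradiction c<y (ℕₚ.≤⇒≯ y≤c)
    upper : ∀ {c} → Edge G v (p c) → rank c < rank y → Edge H c y × page c y ≡ true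
    upper e c<y with nbr e
    ... | inj₁ refl          = contradiction c<y (ℕₚ.<-irrefl refl)
    ... | inj₂ (cy , _ , up) = cy , up
    vb×cd : ∀ {b c d} → Edge G v (p b) → Edge H c d → page c d ≡ false →
            rank y ≤ rank c → rank c < rank b → rank b < rank d → ⊥
    vb×cd vb _ _ y≤c c<b _ = ℕₚ.<⇒≱ c<b (ℕₚ.≤-trans (≤y vb) y≤c)
    av×cd : ∀ {a c d} → Edge G v (p a) → Edge H c d → page c d ≡ true →
            rank a < rank c → rank c < rank y → rank y ≤ rank d → ⊥
    av×cd {a} {c} {d} va cd up a<c c<y y≤d
      with ay , up′ ← upper va (ℕₚ.<-trans a<c c<y) | ℕₚ.m≤n⇒m<n∨m≡n y≤d
    ... | inj₁ y<d = noncrossing ay cd (trans up′ (sym up)) a<c c<y y<d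
    ... | inj₂ y≡d with refl ← rank-injective y d y≡d =
      ℕₚ.<-irrefl (cong rank (left-unique ay cd up′ up (ℕₚ.<-trans a<c c<y) c<y)) a<c
    ab×vd : ∀ {a b d} → Edge G v (p d) → Edge H a b → page a b ≡ false →
            rank a < rank y → rank y ≤ rank b → rank b < rank d → ⊥
    ab×vd vd _ _ _ y≤b b<d = ℕₚ.<⇒≱ b<d (ℕₚ.≤-trans (≤y vd) y≤b)
    ab×cv : ∀ {a b c} → Edge G v (p c) → Edge H a b → page a b ≡ true →
            rank a < rank c → rank c < rank b → rank b < rank y → ⊥
    ab×cv vc ab up a<c c<b b<y with cy , up′ ← upper vc (ℕₚ.<-trans c<b b<y) =
      noncrossing ab cy (trans up (sym up′)) a<c c<b b<y
    left : ∀ {a b} → Edge G v (p a) → Edge G v (p b) → rank a < rank y → rank b < rank y → a ≡ b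
    left va vb a<y b<y with ay , ua ← upper va a<y | by , ub ← upper vb b<y =
      left-unique ay by ua ub a<y b<y
    right : ∀ {a b} → Edge G v (p a) → Edge G v (p b) → rank y ≤ rank a → rank y ≤ rank b → a ≡ b
    right va vb y≤a y≤b = trans (is-y va y≤a) (sym (is-y vb y≤b))

  -- The page tells where there is room: an upper edge is the only left upper edge at `y`, a lower
  -- one the only right lower edge at `x`.
  insert-at-edge : ∀ {x y} → Edge H x y → rank x < rank y →
                   (∀ {c} → Edge G v (p c) → c ≡ x ⊎ c ≡ y) → Layout G
  insert-at-edge {x} {y} xy x<y ends with page x y in eq
  ... | true  = insert-before y nbr
    where
    nbr : ∀ {c} → Edge G v (p c) → c ≡ y ⊎ (Edge H c y × rank c < rank y × page c y ≡ true)
    nbr e with ends e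
    ... | inj₁ refl = inj₂ (xy , x<y , eq)
    ... | inj₂ refl = inj₁ refl
  ... | false = insert-after x nbr
    where
    nbr : ∀ {c} → Edge G v (p c) → c ≡ x ⊎ (Edge H x c × rank x < rank c × page x c ≡ false)
    nbr e with ends e
    ... | inj₁ refl = inj₁ refl
    ... | inj₂ refl = inj₂ (xy , x<y , eq)

  insert : (∀ {a b} → a ≢ b → Edge G v (p a) → Edge G v (p b) → Edge H a b) →
           (∀ {a b c} → a ≢ b → Edge G v (p a) → Edge G v (p b) → Edge G v (p c) → c ≡ a ⊎ c ≡ b) →
           Layout G
  insert clique two with Finₚ.any? (λ x → Graph.adj G v (p x) Boolₚ.≟ true)
  ... | no none = insert-isolated (λ a e → none (a , e))
  ... | yes (x , vx) with Finₚ.any? (λ y → ¬? (x Fin.≟ y) ×-dec (Graph.adj G v (p y) Boolₚ.≟ true))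
  ...   | no only-x = insert-after x (λ {c} vc → inj₁ (only c vc))
    where
    only : ∀ c → Edge G v (p c) → c ≡ x
    only c vc with x Fin.≟ c
    ... | yes x≡c = sym x≡c
    ... | no x≢c  = contradiction (c , x≢c , vc) only-x
  ...   | yes (y , x≢y , vy) with ℕₚ.<-cmp (rank x) (rank y)
  ...     | tri< x<y _ _ = insert-at-edge (clique x≢y vx vy) x<y (two x≢y vx vy)
  ...     | tri> _ _ y<x = insert-at-edge (clique (x≢y ∘ sym) vy vx) y<x (two (x≢y ∘ sym) vy vx)
  ...     | tri≈ _ x≡y _ = contradiction (rank-injective x y x≡y) x≢y

-- Induction on the number of vertices

neighbour-among? : ∀ {n} (G : Graph n) v a b c → Dec (Edge G v c → c ≡ a ⊎ c ≡ b)
neighbour-among? G v a b c = (Graph.adj G v c Boolₚ.≟ true) →-dec ((c Fin.≟ a) ⊎-dec (c Fin.≟ b))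

two-page : ∀ n (G : Graph n) wt (wt-sym : ∀ u v → wt u v ≡ wt v u) →
           Weighted.CyclesAdmissible G wt wt-sym → Layout G
two-page zero G wt wt-sym adm = record
  { rank = λ () ; rank-injective = λ () ; page = λ ()
  ; noncrossing = λ {a} → contradiction a λ ()
  ; left-unique = λ {a} → contradiction a λ ()
  ; right-unique = λ {a} → contradiction a λ () }
two-page (suc n) G wt wt-sym adm
  -- The vertices `a` and `b` need be neither distinct nor adjacent to `v`, so degrees 0 and 1 are
  -- included, and a failed search yields exactly the hypothesis `third`.
  with Finₚ.any? (λ v → Finₚ.any? λ a → Finₚ.any? λ b → Finₚ.all? (neighbour-among? G v a b))
... | yes (v , a , b , only) =
  Insertion.insert (two-page n eliminate wt′ wt′-sym (eliminate-admissible two adm)) G v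
    edge-kept neighbours-joined
    (λ {x} {y} {z} x≢y vx vy vz → Sum.map (Finₚ.punchIn-injective v z x) (Finₚ.punchIn-injective v z y)
      (two (x≢y ∘ Finₚ.punchIn-injective v x y) vx vy vz))
  where
  open Elimination G wt wt-sym v
  two : ∀ {x y z} → x ≢ y → Edge G v x → Edge G v y → Edge G v z → z ≡ x ⊎ z ≡ y
  two x≢y vx vy vz with only _ vx | only _ vy | only _ vz
  ... | inj₁ refl | _         | inj₁ refl = inj₁ refl
  ... | inj₂ refl | _         | inj₂ refl = inj₁ refl
  ... | _         | inj₁ refl | inj₁ refl = inj₂ refl
  ... | _         | inj₂ refl | inj₂ refl = inj₂ refl
  ... | inj₁ refl | inj₁ refl | _         = contradiction refl x≢y
  ... | inj₂ refl | inj₂ refl | _         = contradiction refl x≢y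
... | no none = ⊥-elim (min-degree-3-impossible G wt wt-sym adm third zero)
  where
  third : ∀ v a b → ∃ λ c → Edge G v c × c ≢ a × c ≢ b
  third v a b with Finₚ.¬∀⟶∃¬ _ _ (neighbour-among? G v a b) (λ h → none (v , a , b , h))
  ... | c , ¬nbr with Graph.adj G v c Boolₚ.≟ true
  ...   | yes vc = c , vc , (λ c≡a → ¬nbr λ _ → inj₁ c≡a) , (λ c≡b → ¬nbr λ _ → inj₂ c≡b)
  ...   | no ¬vc = contradiction (λ vc → contradiction vc ¬vc) ¬nbr

-- Unit weights and the cycles of the given graph

module _ {n : ℕ} (G : Graph n) where
  open Weighted G (λ _ _ → 1) (λ _ _ → refl)

  weight≡length : ∀ u xs v → weight u xs v ≡ suc (length xs)
  weight≡length u []       v = refl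
  weight≡length u (x ∷ xs) v = cong suc (weight≡length x xs v)

  walk-steps : ∀ u xs v → Walk u xs v → ∀ (i : Fin (length xs)) →
               Edge G (lookup (u ∷ xs) (Fin.inject₁ i)) (lookup (u ∷ xs) (suc i))
  walk-steps u (x ∷ xs) v (e , p) zero    = e
  walk-steps u (x ∷ xs) v (e , p) (suc i) = walk-steps x xs v p i

  walk-last : ∀ u xs v → Walk u xs v → Edge G (lookup (u ∷ xs) (Fin.fromℕ (length xs))) v
  walk-last u []       v e       = e
  walk-last u (x ∷ xs) v (e , p) = walk-last x xs v p

  InE12⇒admissible : InE12 G → CyclesAdmissible
  InE12⇒admissible _ u (_ ∷ []) (s≤s ())
  InE12⇒admissible (_ , cycles , _) u xs@(x ∷ y ∷ zs) _ p d =
    subst Admissible (sym (weight≡length u xs u)) (cycles record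
      -- The vertices `u`, `x` and `y` are the three that a `Cycle` has besides its `m`.
      { m = length zs ; vert = lookup (u ∷ xs) ; inj = lookup-injective d
      ; path = walk-steps u xs u p ; close = walk-last u xs u p })

mainTheorem15 : ∀ (n : ℕ) (G : Graph n) → InE12 G → Planar G
mainTheorem15 n G G∈ε₁₂ =
  Drawing.planar G (two-page n G (λ _ _ → 1) (λ _ _ → refl) (InE12⇒admissible G G∈ε₁₂))
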